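{- (Reciprocity theorem on hypergraphs.) Let $I$ be a finite set and let $H$ be a hypergraph over $I$. Then for every nonnegative integer $n$, $(-1)^{|I|}\chi_I(H)(-n)$ is the number of pairs $(f,S)$ where $f$ is an acyclic orientation of $H$, $S$ is a coloring of $H$ with $[n]$, and $f$ and $S$ are compatible. In particular, $(-1)^{|I|}\chi_I(H)(-1)=|\mathcal{A}_H|$ is the number of acyclic orientations of $H$.
   Context: Notation: $[n]=\{1,\dots,n\}$. A decomposition of a finite set $I$ of length $n$ is a sequence $(S_1,\dots,S_n)$ of pairwise disjoint (possibly empty) sets with union $I$. Hypergraphs. A hypergraph $H$ over a finite set $I$ is a finite multiset of (possibly repeated) subsets of $I$, called edges, containing $\emptyset$ exactly once. Elements of $I$ are vertices. For $I=S\sqcup T$, the restriction $H_{|S}$ is the multiset $\{e\in H: e\subseteq S\}$ (a hypergraph over $S$) and the contraction $H_{/S}$ is the multiset $\{e\cap T: e\in H,\ e\nsubseteq S\}\cup\{\emptyset\}$ (a hypergraph over $T$), multiplicities being kept. The Hopf monoid of hypergraphs has product given by union of edges ($H_1\otimes H_2\mapsto H_1\sqcup H_2$, with $\emptyset$ kept once) and coproduct $\Delta_{S,T}(H)=H_{|S}\otimes H_{/S}$. The iterated coproduct along a decomposition $(S_1,\dots,S_n)$ of $I$ is $\Delta_{S_1,\dots,S_n}(H)=H_1\otimes\cdots\otimes H_n$ with $H_i=(H_{|S_1\sqcup\cdots\sqcup S_i})_{/S_1\sqcup\cdots\sqcup S_{i-1}}$. Basic invariant. A hypergraph is discrete if all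 its edges have cardinality at most $1$. Let $\zeta(H)=1$ if $H$ is discrete and $\zeta(H)=0$ otherwise. For a nonnegative integer $n$, $$\chi_I(H)(n)=\sum_{(S_1,\dots,S_n)}\zeta(H_1)\cdots\zeta(H_n),$$ the sum being over all decompositions of $I$ of length $n$, with $\Delta_{S_1,\dots,S_n}(H)=H_1\otimes\cdots\otimes H_n$. It is known that $\chi_I(H)(n)$ is a polynomial in $n$; $\chi_I(H)(-n)$ denotes the value of this polynomial at $-n$. Colorings and orientations. A coloring of $H$ with $[n]$ is a function $S:I\to[n]$. An orientation of $H$ is a function $f$ assigning to each nonempty edge $e$ of $H$ (repeated edges being treated as distinct elements) a vertex $f(e)\in e$. A directed cycle of $f$ is a sequence of distinct edges $e_1,\dots,e_k$ with $f(e_1)\in e_2\setminus\{f(e_2)\},\dots,f(e_{k-1})\in e_k\setminus\{f(e_k)\},\ f(e_k)\in e_1\setminus\{f(e_1)\}$. The orientation is acyclic if it has no directed cycle, and $\mathcal{A}_H$ is the set of acyclic orientations of $H$. An orientation $f$ and a coloring $S$ are compatible if $S(f(e))=\max S(e)$ for every nonempty edge $e\in H$. -}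

module Defs where

open import Data.Bool using (if_then_else_)
import Data.Bool as Bool
open import Data.Empty using (⊥-elim)
open import Data.Fin using (Fin; zero; suc; toℕ; fromℕ; inject₁)
import Data.Fin as Fin
open import Data.Fin.Subset
open import Data.Fin.Subset.Properties
open import Data.Integer using (ℤ; +_)
open import Data.List using (List; []; _∷_; length; filter; map; foldr; tabulate; take; lookup; cartesianProductWith)
open import Data.List.Properties using (filter-accept; filter-none)
open import Data.List.Relation.Unary.All as All using (All; []; _∷_)
import Data.List.Relation.Unary.All.Properties as All
open import Data.Nat using (ℕ; zero; suc; _≤_; _≤?_)
open import Data.Nat.ListAction using (sum; product)
open import Data.Product using (Σ-syntax; ∃; _×_; _,_)
open import Data.Rational using (ℚ; 0ℚ)
import Data.Rational as ℚ
open import Data.Vec using (Vec; []; _∷_; toList)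
open import Data.Vec.Properties using (≡-dec)
open import Data.Vec.Relation.Unary.AllPairs using (AllPairs; allPairs?)
open import Function.Bundles using (Inverse)
open import Function.Definitions using (Injective)
open import Level using (0ℓ)
open import Relation.Binary.Bundles using (Setoid)
open import Relation.Binary.Definitions using (DecidableEquality)
open import Relation.Binary.PropositionalEquality using (_≡_; refl; sym; trans; cong; subst; setoid; _≗_)
open import Relation.Nullary using (¬_; Dec; yes; no; does; ¬?; _×-dec_; contradiction)

private
  variable
    m n : ℕ

_≟ˢ_ : DecidableEquality (Subset m)
_≟ˢ_ = ≡-dec Bool._≟_

------------------------------------------------------------------------
-- Hypergraphs

-- Vertex sets are subsets of an ambient Fin m, so that restrictions and
-- contractions need no relabelling.  The multiset of edges is given by a list;
-- repeated edges occupy different positions.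

record Hypergraph (I : Subset m) : Set where
  field
    edges   : List (Subset m)
    edges⊆I : All (_⊆ I) edges
    ∅-once  : length (filter (_≟ˢ ⊥) edges) ≡ 1

open Hypergraph public

restrictEdges : Subset m → List (Subset m) → List (Subset m)
restrictEdges S = filter (_⊆? S)

contractEdges : (I S : Subset m) → List (Subset m) → List (Subset m)
contractEdges I S es = ⊥ ∷ map (_∩ (I ─ S)) (filter (λ e → ¬? (e ⊆? S)) es)

private
  restrict-∅ : (S : Subset m) (es : List (Subset m)) →
    length (filter (_≟ˢ ⊥) (restrictEdges S es)) ≡ length (filter (_≟ˢ ⊥) es)
  restrict-∅ S [] = refl
  restrict-∅ S (e ∷ es) with e ⊆? S
  ... | yes _ with e ≟ˢ ⊥
  ...   | yes _ = cong suc (restrict-∅ S es)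
  ...   | no _  = restrict-∅ S es
  restrict-∅ S (e ∷ es) | no e⊈S with e ≟ˢ ⊥
  ...   | yes refl = ⊥-elim (e⊈S (⊆-min S))
  ...   | no _     = restrict-∅ S es

  trace≢∅ : (I S e : Subset m) → e ⊆ I → e ⊈ S → ¬ (e ∩ (I ─ S) ≡ ⊥)
  trace≢∅ I S e e⊆I e⊈S eq = e⊈S λ {x} x∈e → inS x x∈e
    where
    inS : ∀ x → x ∈ e → x ∈ S
    inS x x∈e with x ∈? S
    ... | yes x∈S = x∈S
    ... | no x∉S  = contradiction
      (subst (x ∈_) eq (x∈p∩q⁺ (x∈e , x∈p∧x∉q⇒x∈p─q (e⊆I x∈e) x∉S))) ∉⊥

  contract-∅ : (I S : Subset m) (es : List (Subset m)) → All (_⊆ I) es →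
    length (filter (_≟ˢ ⊥) (contractEdges I S es)) ≡ 1
  contract-∅ I S es es⊆I = trans
    (cong length (filter-accept (_≟ˢ ⊥) {x = ⊥}
      {xs = map (_∩ (I ─ S)) (filter (λ e → ¬? (e ⊆? S)) es)} refl))
    (cong (λ xs → suc (length xs)) (filter-none (_≟ˢ ⊥) (All.map⁺ (traces es es⊆I))))
    where
    traces : ∀ xs → All (_⊆ I) xs →
      All (λ e → ¬ (e ∩ (I ─ S) ≡ ⊥)) (filter (λ e → ¬? (e ⊆? S)) xs)
    traces [] [] = []
    traces (e ∷ xs) (e⊆I ∷ xs⊆I) with e ⊆? S
    ... | yes _  = traces xs xs⊆I
    ... | no e⊈S = trace≢∅ I S e e⊆I e⊈S ∷ traces xs xs⊆I

infixl 9 _∣ʳ_ _/ᶜ_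

-- H restricted to S; only meaningful for S ⊆ I.
_∣ʳ_ : {I : Subset m} → Hypergraph I → (S : Subset m) → Hypergraph S
edges   (H ∣ʳ S) = restrictEdges S (edges H)
edges⊆I (H ∣ʳ S) = All.all-filter (_⊆? S) (edges H)
∅-once  (H ∣ʳ S) = trans (restrict-∅ S (edges H)) (∅-once H)

-- H contracted by S; only meaningful for S ⊆ I.
_/ᶜ_ : {I : Subset m} → Hypergraph I → (S : Subset m) → Hypergraph (I ─ S)
edges   (_/ᶜ_ {I = I} H S) = contractEdges I S (edges H)
edges⊆I (_/ᶜ_ {I = I} H S) =
  ⊆-min (I ─ S) ∷
  All.map⁺ (All.universal {P = λ e → e ∩ (I ─ S) ⊆ I ─ S} (λ e → p∩q⊆q e (I ─ S)) _)
∅-once  (_/ᶜ_ {I = I} H S) = contract-∅ I S (edges H) (edges⊆I H)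

------------------------------------------------------------------------
-- Decompositions and the iterated coproduct

words : {A : Set} → List A → (n : ℕ) → List (Vec A n)
words xs zero    = [] ∷ []
words xs (suc n) = cartesianProductWith _∷_ xs (words xs n)

subsets : (m : ℕ) → List (Subset m)
subsets = words (outside ∷ inside ∷ [])

IsDecomposition : Subset m → Vec (Subset m) n → Set
IsDecomposition I Ss = AllPairs (λ S T → S ∩ T ≡ ⊥) Ss × ⋃ (toList Ss) ≡ I

isDecomposition? : (I : Subset m) (Ss : Vec (Subset m) n) → Dec (IsDecomposition I Ss)
isDecomposition? I Ss =
  allPairs? (λ S T → (S ∩ T) ≟ˢ ⊥) Ss ×-dec (⋃ (toList Ss) ≟ˢ I)

decompositions : Subset m → (n : ℕ) → List (Vec (Subset m) n)
decompositions {m} I n = filter (isDecomposition? I) (words (subsets m) n)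

-- prefix Ss k is the union of the first k members of Ss.
prefix : Vec (Subset m) n → ℕ → Subset m
prefix Ss k = ⋃ (take k (toList Ss))

-- The tensor factors of the iterated coproduct; Fin n is 0-based, so the index
-- i stands for the (i+1)-st factor.
Δ : {I : Subset m} → Hypergraph I → (Ss : Vec (Subset m) n) (i : Fin n) →
    Hypergraph (prefix Ss (suc (toℕ i)) ─ prefix Ss (toℕ i))
Δ H Ss i = (H ∣ʳ prefix Ss (suc (toℕ i))) /ᶜ prefix Ss (toℕ i)

------------------------------------------------------------------------
-- The basic invariant

Discrete : {I : Subset m} → Hypergraph I → Set
Discrete H = All (λ e → ∣ e ∣ ≤ 1) (edges H)

discrete? : {I : Subset m} (H : Hypergraph I) → Dec (Discrete H)
discrete? H = All.all? (λ e → ∣ e ∣ ≤? 1) (edges H)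

ζ : {I : Subset m} → Hypergraph I → ℕ
ζ H = if does (discrete? H) then 1 else 0

χ : {I : Subset m} → Hypergraph I → ℕ → ℕ
χ {I = I} H n =
  sum (map (λ Ss → product (tabulate λ i → ζ (Δ H Ss i))) (decompositions I n))

------------------------------------------------------------------------
-- Polynomials over ℚ, as coefficient lists with the constant term first

Polynomial : Set
Polynomial = List ℚ

fromℤ : ℤ → ℚ
fromℤ i = i ℚ./ 1

eval : Polynomial → ℤ → ℚ
eval p i = foldr (λ a r → a ℚ.+ fromℤ i ℚ.* r) 0ℚ p

-- Such a p is unique up to trailing zeros, so its values are determined by H.
_IsPolynomialOf_ : {I : Subset m} → Polynomial → Hypergraph I → Set
p IsPolynomialOf H = ∀ n → eval p (+ n) ≡ fromℤ (+ χ H n)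

------------------------------------------------------------------------
-- Orientations and colorings

module _ {I : Subset m} (H : Hypergraph I) where

  nonemptyEdges : List (Subset m)
  nonemptyEdges = filter nonempty? (edges H)

  Edge : Set
  Edge = Fin (length nonemptyEdges)

  ⟦_⟧ : Edge → Subset m
  ⟦_⟧ = lookup nonemptyEdges

  Orientation : Set
  Orientation = Σ[ f ∈ (Edge → Fin m) ] (∀ e → f e ∈ ⟦ e ⟧)

  _≈ᵒ_ : Orientation → Orientation → Set
  (f , _) ≈ᵒ (g , _) = f ≗ g

  -- A cycle e₁, …, eₖ has k ≥ 1 edges.
  DirectedCycle : Orientation → Set
  DirectedCycle (f , _) =
    ∃ λ k → Σ[ e ∈ (Fin (suc k) → Edge) ]
      Injective _≡_ _≡_ e
      × (∀ i → f (e (inject₁ i)) ∈ ⟦ e (suc i) ⟧ - f (e (suc i)))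
      × f (e (fromℕ k)) ∈ ⟦ e zero ⟧ - f (e zero)

  Acyclic : Orientation → Set
  Acyclic f = ¬ DirectedCycle f

Coloring : (m n : ℕ) → Set
Coloring m n = Fin m → Fin n

IsMaxOn : Coloring m n → Subset m → Fin n → Set
IsMaxOn S e c = (∃ λ v → v ∈ e × S v ≡ c) × (∀ v → v ∈ e → S v Fin.≤ c)

Compatible : (H : Hypergraph (⊤ {m})) → Orientation H → Coloring m n → Set
Compatible H (f , _) S = ∀ e → IsMaxOn S (⟦_⟧ H e) (S (f e))

------------------------------------------------------------------------
-- Counting

-- Orientations and colorings are functions, hence compared pointwise.

AcyclicOrientations : {I : Subset m} → Hypergraph I → Setoid 0ℓ 0ℓ
AcyclicOrientations H = record
  { Carrier       = Σ[ f ∈ Orientation H ] Acyclic H f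
  ; _≈_           = λ (f , _) (g , _) → _≈ᵒ_ H f g
  ; isEquivalence = record
    { refl  = λ _ → refl
    ; sym   = λ p e → sym (p e)
    ; trans = λ p q e → trans (p e) (q e)
    }
  }

CompatiblePairs : Hypergraph (⊤ {m}) → ℕ → Setoid 0ℓ 0ℓ
CompatiblePairs {m} H n = record
  { Carrier       = Σ[ (f , S) ∈ Orientation H × Coloring m n ]
                      Acyclic H f × Compatible H f S
  ; _≈_           = λ ((f , S) , _) ((g , T) , _) → _≈ᵒ_ H f g × S ≗ T
  ; isEquivalence = record
    { refl  = (λ _ → refl) , (λ _ → refl)
    ; sym   = λ (p , q) → (λ e → sym (p e)) , (λ v → sym (q v))
    ; trans = λ (p , q) (p′ , q′) →
                (λ e → trans (p e) (p′ e)) , (λ v → trans (q v) (q′ v))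
    }
  }

HasCardinality : Setoid 0ℓ 0ℓ → ℕ → Set
HasCardinality X k = Inverse (setoid (Fin k)) X

{-# OPTIONS --safe #-}

-- A coloring in which every edge has a unique vertex of maximal color orients
-- each edge towards that vertex, so χ(n) is the sum, over the acyclic
-- orientations f, of the number of colorings that strictly increase along the
-- arcs v → f(e), v ∈ e ∖ {f(e)}.  It remains to prove the reciprocity of strict
-- and weak order polynomials for one acyclic relation.  Peeling off the lowest
-- color, the strict polynomials Ω_A of the sets A of vertices satisfy
-- Ω_A(x+1) = Σ_T Ω_{A∖T}(x), the sum over the sets T ⊆ A that no arc from A
-- enters.  An involution shows that the matrix of this recursion is inverted by
-- the signed matrix of the steps A ↦ A∖U with U entered by no arc from A∖U,
-- which are the steps of the weak colorings.

module Submission where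

open import Defs
open import Algebra.Bundles using (Group; AbelianGroup)
open import Data.Bool using (Bool; true; false; not; T; if_then_else_)
import Data.Bool.Properties as Bool
open import Data.Fin using (Fin; zero; suc; toℕ; fromℕ; inject₁)
import Data.Fin as Fin
import Data.Fin.Properties as Fin
open import Data.Fin.Relation.Unary.Top using (view; ‵fromℕ; ‵inject₁)
open import Data.Fin.Subset
open import Data.Fin.Subset.Properties
open import Data.Integer using (ℤ; +_; -[1+_]; 0ℤ; 1ℤ; -1ℤ; _+_; _*_; -_; _^_)
import Data.Integer as ℤ
import Data.Integer.Properties as ℤ
open import Data.Integer.Tactic.RingSolver using (solve-∀)
open import Data.List using (List; []; _∷_; _++_; map; filter; length; allFin; cartesianProduct; cartesianProductWith)
import Data.List as List
open import Data.List.Membership.Propositional using () renaming (_∈_ to _∈ₗ_)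
open import Data.List.Membership.Propositional.Properties
  using (∈-allFin; ∈-lookup; ∈-filter⁺; ∈-filter⁻; ∈-map⁺; ∈-cartesianProduct⁺; ∈-cartesianProductWith⁺)
open import Data.List.Relation.Unary.All as All using ([]; _∷_)
import Data.List.Relation.Unary.All.Properties as All
open import Data.List.Relation.Unary.AllPairs using ([]; _∷_)
open import Data.List.Relation.Unary.Any as Any using (here; there)
open import Data.List.Relation.Unary.Any.Properties using (lookup-index)
open import Data.List.Relation.Unary.Unique.Propositional using (Unique)
import Data.List.Relation.Unary.Unique.Propositional.Properties as Unique
open import Data.Nat using (ℕ; zero; suc; s≤s; z≤n)
import Data.Nat as ℕ
open import Data.Nat.ListAction using (product) renaming (sum to sumℕ)
import Data.Nat.Properties as ℕ
open import Data.Product using (∃; _×_; _,_; proj₁; proj₂)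
import Data.Product.Properties as Product
open import Data.Rational using (ℚ; 0ℚ; 1ℚ)
import Data.Rational as ℚ
import Data.Rational.Properties as ℚ
open import Data.Rational.Solver using (module +-*-Solver)
import Data.Rational.Unnormalised as ℚᵘ
import Data.Rational.Unnormalised.Properties as ℚᵘ
open import Data.Sum using (_⊎_; inj₁; inj₂)
open import Data.Vec as Vec using (Vec; []; _∷_; here; there; lookup; tabulate; toList)
import Data.Vec.Properties as Vec
import Data.Vec.Relation.Unary.All.Properties as VecAll
open import Data.Vec.Relation.Unary.AllPairs using (AllPairs; []; _∷_)
open import Function using (_∘_; id)
open import Function.Bundles using (Inverse)
open import Function.Construct.Composition using (inverse)
open import Level using (0ℓ)
open import Relation.Binary.Bundles using (Setoid)
open import Relation.Binary.Definitions using (DecidableEquality)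
open import Relation.Binary.PropositionalEquality hiding (J)
open import Relation.Nullary using (¬_; Dec; yes; no; does; ¬?; _×-dec_; _→-dec_; contradiction)
open import Relation.Nullary.Decidable using (dec-true)

-- Counting cannot reach the value of a polynomial at -n, so the order polynomials are functions on
-- all of ℤ from the start. In the recursion for Ω_A the term T = ∅ is Ω_A(x) itself; hence the
-- difference Ω_A(x+1) - Ω_A(x) involves smaller sets only, and summing differences from 0 in both
-- directions defines Ω_A on ℤ as an integer combination of the C(x,k). The recursion then holds at
-- negative x as well. Running it backwards is where the inverse matrix enters: it expresses Ω_A(x)
-- through the values at x+1 for the sets A ─ U, and at x = -(n+1) this is, up to the sign (-1)^∣A∣,
-- the recursion that counts weak colorings with n+1 colors. The involution relies on acyclicity in
-- the form that every nonempty set of vertices has a sink: the sink is the vertex that it moves.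
-- This form is also decidable, so a sum over acyclic orientations can be written as a sum over all
-- functions from edges to vertices, weighted by an indicator.

private variable
  A B P Q : Set
  m n : ℕ

-- Sums over finite types

𝟙 : Dec P → ℤ
𝟙 p? = if does p? then 1ℤ else 0ℤ

𝟙-yes : (p? : Dec P) → P → 𝟙 p? ≡ 1ℤ
𝟙-yes (yes _) _ = refl
𝟙-yes (no ¬p) p = contradiction p ¬p

𝟙-no : (p? : Dec P) → ¬ P → 𝟙 p? ≡ 0ℤ
𝟙-no (yes p) ¬p = contradiction p ¬p
𝟙-no (no _)  _  = refl

𝟙≢0 : (p? : Dec P) → 𝟙 p? ≢ 0ℤ → P
𝟙≢0 (yes p) _ = p
𝟙≢0 (no _)  h = contradiction refl h

𝟙-cong : (p? : Dec P) (q? : Dec Q) → (P → Q) → (Q → P) → 𝟙 p? ≡ 𝟙 q?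
𝟙-cong (yes p) q? f g = sym (𝟙-yes q? (f p))
𝟙-cong (no ¬p) q? f g = sym (𝟙-no q? (¬p ∘ g))

𝟙-× : (p? : Dec P) (q? : Dec Q) → 𝟙 (p? ×-dec q?) ≡ 𝟙 p? * 𝟙 q?
𝟙-× (yes _) (yes _) = refl
𝟙-× (yes _) (no _)  = refl
𝟙-× (no _)  q?      = refl

𝟙*-cong : (p? : Dec P) {x y : ℤ} → (P → x ≡ y) → 𝟙 p? * x ≡ 𝟙 p? * y
𝟙*-cong (yes p) h = cong (1ℤ *_) (h p)
𝟙*-cong (no _)  h = refl

∑ : List A → (A → ℤ) → ℤ
∑ []       f = 0ℤ
∑ (x ∷ xs) f = f x + ∑ xs f

∑-cong : (xs : List A) {f g : A → ℤ} → f ≗ g → ∑ xs f ≡ ∑ xs g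
∑-cong []       h = refl
∑-cong (x ∷ xs) h = cong₂ _+_ (h x) (∑-cong xs h)

∑-zero : (xs : List A) {f : A → ℤ} → (∀ x → f x ≡ 0ℤ) → ∑ xs f ≡ 0ℤ
∑-zero []       h = refl
∑-zero (x ∷ xs) h = trans (cong₂ _+_ (h x) (∑-zero xs h)) refl

+-interchange : ∀ a b c d → a + b + (c + d) ≡ a + c + (b + d)
+-interchange = solve-∀

∑-+ : (xs : List A) (f g : A → ℤ) → ∑ xs (λ x → f x + g x) ≡ ∑ xs f + ∑ xs g
∑-+ []       f g = refl
∑-+ (x ∷ xs) f g = trans (cong (_+_ (f x + g x)) (∑-+ xs f g)) (+-interchange (f x) (g x) _ (∑ xs g))

∑-*ˡ : (xs : List A) (c : ℤ) (f : A → ℤ) → ∑ xs (λ x → c * f x) ≡ c * ∑ xs f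
∑-*ˡ []       c f = sym (ℤ.*-zeroʳ c)
∑-*ˡ (x ∷ xs) c f = trans (cong (_+_ (c * f x)) (∑-*ˡ xs c f)) (sym (ℤ.*-distribˡ-+ c _ _))

∑-*ʳ : (xs : List A) (f : A → ℤ) (c : ℤ) → ∑ xs (λ x → f x * c) ≡ ∑ xs f * c
∑-*ʳ xs f c = trans (∑-cong xs λ x → ℤ.*-comm (f x) c) (trans (∑-*ˡ xs c f) (ℤ.*-comm c _))

∑-swap : (xs : List A) (ys : List B) (k : A → B → ℤ) →
  ∑ xs (λ x → ∑ ys (k x)) ≡ ∑ ys (λ y → ∑ xs (λ x → k x y))
∑-swap []       ys k = sym (∑-zero ys λ _ → refl)
∑-swap (x ∷ xs) ys k = trans (cong (_+_ (∑ ys (k x))) (∑-swap xs ys k)) (sym (∑-+ ys _ _))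

∑-++ : (xs ys : List A) (f : A → ℤ) → ∑ (xs ++ ys) f ≡ ∑ xs f + ∑ ys f
∑-++ []       ys f = sym (ℤ.+-identityˡ _)
∑-++ (x ∷ xs) ys f = trans (cong (_+_ (f x)) (∑-++ xs ys f)) (sym (ℤ.+-assoc (f x) _ _))

∑-map : (h : A → B) (xs : List A) (f : B → ℤ) → ∑ (map h xs) f ≡ ∑ xs (f ∘ h)
∑-map h []       f = refl
∑-map h (x ∷ xs) f = cong (_+_ (f (h x))) (∑-map h xs f)

∑-cartesianProductWith : {C : Set} (h : A → B → C) (xs : List A) (ys : List B) (f : C → ℤ) →
  ∑ (cartesianProductWith h xs ys) f ≡ ∑ xs (λ x → ∑ ys (λ y → f (h x y)))
∑-cartesianProductWith h []       ys f = refl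
∑-cartesianProductWith h (x ∷ xs) ys f = trans (∑-++ (map (h x) ys) _ f)
  (cong₂ _+_ (∑-map (h x) ys f) (∑-cartesianProductWith h xs ys f))

∑-𝟙-length : {P : A → Set} (P? : ∀ x → Dec (P x)) (xs : List A) →
  ∑ xs (λ x → 𝟙 (P? x)) ≡ + length (filter P? xs)
∑-𝟙-length P? []       = refl
∑-𝟙-length P? (x ∷ xs) with P? x
... | yes _ = cong (_+_ 1ℤ) (∑-𝟙-length P? xs)
... | no _  = trans (ℤ.+-identityˡ _) (∑-𝟙-length P? xs)

-- Uniqueness and completeness make every element count exactly once, so a sum does not depend on
-- the enumeration and can be reindexed.
record Finite (A : Set) : Set where
  field
    elems    : List A
    unique   : Unique elems
    complete : ∀ x → x ∈ₗ elems
    _≟_      : DecidableEquality A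

  sum : (A → ℤ) → ℤ
  sum = ∑ elems

open Finite using (sum)

module _ (_≟_ : DecidableEquality A) where

  ∑-delta-∉ : (xs : List A) {z : A} (f : A → ℤ) → All.All (z ≢_) xs →
    ∑ xs (λ x → 𝟙 (x ≟ z) * f x) ≡ 0ℤ
  ∑-delta-∉ []       f []       = refl
  ∑-delta-∉ (x ∷ xs) {z} f (p ∷ ps) = cong₂ _+_
    (cong (_* f x) (𝟙-no (x ≟ z) (p ∘ sym))) (∑-delta-∉ xs f ps)

  ∑-delta : {xs : List A} {z : A} (f : A → ℤ) → Unique xs → z ∈ₗ xs →
    ∑ xs (λ x → 𝟙 (x ≟ z) * f x) ≡ f z
  ∑-delta {xs = x ∷ xs} f (p ∷ _) (here refl) = trans
    (cong₂ _+_ (cong (_* f x) (𝟙-yes (x ≟ x) refl)) (∑-delta-∉ xs f p))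
    (trans (ℤ.+-identityʳ _) (ℤ.*-identityˡ _))
  ∑-delta {xs = x ∷ xs} {z} f (p ∷ u) (there z∈) = trans
    (cong₂ _+_ (cong (_* f x) (𝟙-no (x ≟ z) (All.lookup p z∈))) (∑-delta f u z∈))
    (ℤ.+-identityˡ _)

sum-delta : (𝓐 : Finite A) (z : A) (f : A → ℤ) →
  sum 𝓐 (λ x → 𝟙 (Finite._≟_ 𝓐 x z) * f x) ≡ f z
sum-delta 𝓐 z f = ∑-delta (Finite._≟_ 𝓐) f (Finite.unique 𝓐) (Finite.complete 𝓐 z)

-- Both sides count the pairs (ψ y , y), weighted by g y.
sum-reindex : (𝓐 : Finite A) (𝓑 : Finite B) {f : A → ℤ} {g : B → ℤ} (ψ : B → A) →
  (∀ y → g y ≢ 0ℤ → f (ψ y) ≡ g y) →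
  (∀ y y′ → g y ≢ 0ℤ → g y′ ≢ 0ℤ → ψ y ≡ ψ y′ → y ≡ y′) →
  (∀ x → f x ≢ 0ℤ → ∃ λ y → ψ y ≡ x × g y ≢ 0ℤ) →
  sum 𝓐 f ≡ sum 𝓑 g
sum-reindex 𝓐 𝓑 {f} {g} ψ f∘ψ inj surj = begin
  sum 𝓐 f                                            ≡⟨ ∑-cong (A.elems) rows ⟩
  sum 𝓐 (λ x → sum 𝓑 λ y → 𝟙 (x A.≟ ψ y) * g y)     ≡⟨ ∑-swap A.elems B.elems _ ⟩
  sum 𝓑 (λ y → sum 𝓐 λ x → 𝟙 (x A.≟ ψ y) * g y)     ≡⟨ ∑-cong B.elems (λ y → sum-delta 𝓐 (ψ y) (λ _ → g y)) ⟩
  sum 𝓑 g                                            ∎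
  where
  open ≡-Reasoning
  module A = Finite 𝓐
  module B = Finite 𝓑
  -- At most one y over x has nonzero weight: none if `f x` is 0, and only `y₀` otherwise. The map
  -- `ψ` therefore has to be a bijection between the supports only.
  rows : ∀ x → f x ≡ sum 𝓑 λ y → 𝟙 (x A.≟ ψ y) * g y
  rows x with f x ℤ.≟ 0ℤ
  ... | yes fx≡0 = trans fx≡0 (sym (∑-zero B.elems vanish))
    where
    vanish : ∀ y → 𝟙 (x A.≟ ψ y) * g y ≡ 0ℤ
    vanish y with x A.≟ ψ y | g y ℤ.≟ 0ℤ
    ... | no _     | _       = refl
    ... | yes _    | yes gy≡0 = cong (1ℤ *_) gy≡0
    ... | yes refl | no gy≢0 = contradiction (trans (sym (f∘ψ y gy≢0)) fx≡0) gy≢0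
  ... | no fx≢0 with surj x fx≢0
  ...   | y₀ , refl , gy₀≢0 = sym (trans (∑-cong B.elems row) (sum-delta 𝓑 y₀ (λ _ → f x)))
    where
    row : ∀ y → 𝟙 (ψ y₀ A.≟ ψ y) * g y ≡ 𝟙 (y B.≟ y₀) * f x
    row y with y B.≟ y₀
    ... | yes refl = cong₂ _*_ (𝟙-yes (ψ y A.≟ ψ y) refl) (sym (f∘ψ y gy₀≢0))
    ... | no y≢y₀ with ψ y₀ A.≟ ψ y | g y ℤ.≟ 0ℤ
    ...   | no _  | _        = refl
    ...   | yes _ | yes gy≡0 = cong (1ℤ *_) gy≡0
    ...   | yes e | no gy≢0  = contradiction (inj y y₀ gy≢0 gy₀≢0 (sym e)) y≢y₀

sum-𝟙-unique : (𝓐 : Finite A) {Q : A → Set} (Q? : ∀ x → Dec (Q x)) (p? : Dec P) →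
  (∀ {x y} → Q x → Q y → x ≡ y) → (P → ∃ Q) → (∀ {x} → Q x → P) →
  sum 𝓐 (λ x → 𝟙 (Q? x)) ≡ 𝟙 p?
sum-𝟙-unique 𝓐 Q? p? uniq ex P←Q with p?
... | no ¬p = ∑-zero (Finite.elems 𝓐) (λ x → 𝟙-no (Q? x) (¬p ∘ P←Q))
... | yes p with ex p
...   | z , qz = trans (∑-cong (Finite.elems 𝓐) λ x → trans
          (𝟙-cong (Q? x) (x A.≟ z) (λ qx → uniq qx qz) (λ { refl → qz })) (sym (ℤ.*-identityʳ _)))
          (sum-delta 𝓐 z (λ _ → 1ℤ))
  where module A = Finite 𝓐

finFinite : (n : ℕ) → Finite (Fin n)
finFinite n = record
  { elems = allFin n ; unique = Unique.allFin⁺ n ; complete = ∈-allFin ; _≟_ = Fin._≟_ }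

vecFinite : Finite A → (n : ℕ) → Finite (Vec A n)
vecFinite {A} 𝓐 n = record
  { elems = words A.elems n ; unique = words-unique n ; complete = words-complete ; _≟_ = Vec.≡-dec A._≟_ }
  where
  module A = Finite 𝓐
  words-unique : ∀ n → Unique (words A.elems n)
  words-unique zero    = [] ∷ []
  words-unique (suc n) = Unique.cartesianProductWith⁺ _∷_ Vec.∷-injective A.unique (words-unique n)
  words-complete : ∀ {n} (v : Vec A n) → v ∈ₗ words A.elems n
  words-complete []      = here refl
  words-complete (x ∷ v) = ∈-cartesianProductWith⁺ _∷_ (A.complete x) (words-complete v)

_×-finite_ : Finite A → Finite B → Finite (A × B)
𝓐 ×-finite 𝓑 = record
  { elems    = cartesianProduct A.elems B.elems
  ; unique   = Unique.cartesianProduct⁺ A.unique B.unique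
  ; complete = λ (x , y) → ∈-cartesianProduct⁺ (A.complete x) (B.complete y)
  ; _≟_      = Product.≡-dec A._≟_ B._≟_
  }
  where
  module A = Finite 𝓐
  module B = Finite 𝓑

subsetFinite : (m : ℕ) → Finite (Subset m)
subsetFinite = vecFinite record
  { elems    = outside ∷ inside ∷ []
  ; unique   = ((λ ()) ∷ []) ∷ [] ∷ []
  ; complete = λ { false → here refl ; true → there (here refl) }
  ; _≟_      = Bool._≟_
  }

sum-∷ : (𝓐 : Finite A) (F : Vec A (suc n) → ℤ) →
  sum (vecFinite 𝓐 (suc n)) F ≡ sum 𝓐 (λ x → sum (vecFinite 𝓐 n) (λ v → F (x ∷ v)))
sum-∷ {n = n} 𝓐 F = ∑-cartesianProductWith _∷_ (Finite.elems 𝓐) (words (Finite.elems 𝓐) n) F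

-- Polynomials in the binomial basis

-- The fraction `i ℚ./ 1` is normalised by a gcd, which is stuck for a variable `i`. Identities
-- about `fromℤ` are therefore checked on unnormalised fractions, where they become ring identities.
toℚᵘ-fromℤ : ∀ i → ℚ.toℚᵘ (fromℤ i) ℚᵘ.≃ ℚᵘ.mkℚᵘ i 0
toℚᵘ-fromℤ i = ℚ.toℚᵘ-fromℚᵘ (ℚᵘ.mkℚᵘ i 0)

fromℤ-+ : ∀ i j → fromℤ (i + j) ≡ fromℤ i ℚ.+ fromℤ j
fromℤ-+ i j = ℚ.toℚᵘ-injective (begin
  ℚ.toℚᵘ (fromℤ (i + j))                          ≈⟨ toℚᵘ-fromℤ (i + j) ⟩
  ℚᵘ.mkℚᵘ (i + j) 0                               ≈⟨ ℚᵘ.*≡* (cross i j) ⟩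
  ℚᵘ.mkℚᵘ i 0 ℚᵘ.+ ℚᵘ.mkℚᵘ j 0                    ≈⟨ ℚᵘ.+-cong (toℚᵘ-fromℤ i) (toℚᵘ-fromℤ j) ⟨
  ℚ.toℚᵘ (fromℤ i) ℚᵘ.+ ℚ.toℚᵘ (fromℤ j)          ≈⟨ ℚ.toℚᵘ-homo-+ (fromℤ i) (fromℤ j) ⟨
  ℚ.toℚᵘ (fromℤ i ℚ.+ fromℤ j)                    ∎)
  where
  open import Relation.Binary.Reasoning.Setoid ℚᵘ.≃-setoid
  cross : ∀ i j → (i + j) * 1ℤ ≡ (i * 1ℤ + j * 1ℤ) * 1ℤ
  cross = solve-∀

fromℤ-* : ∀ i j → fromℤ (i * j) ≡ fromℤ i ℚ.* fromℤ j
fromℤ-* i j = ℚ.toℚᵘ-injective (begin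
  ℚ.toℚᵘ (fromℤ (i * j))                          ≈⟨ toℚᵘ-fromℤ (i * j) ⟩
  ℚᵘ.mkℚᵘ i 0 ℚᵘ.* ℚᵘ.mkℚᵘ j 0                    ≈⟨ ℚᵘ.*-cong (toℚᵘ-fromℤ i) (toℚᵘ-fromℤ j) ⟨
  ℚ.toℚᵘ (fromℤ i) ℚᵘ.* ℚ.toℚᵘ (fromℤ j)          ≈⟨ ℚ.toℚᵘ-homo-* (fromℤ i) (fromℤ j) ⟨
  ℚ.toℚᵘ (fromℤ i ℚ.* fromℤ j)                    ∎)
  where open import Relation.Binary.Reasoning.Setoid ℚᵘ.≃-setoid

module Differences {ℓ} (𝓖 : Group 0ℓ ℓ) where
  open Group 𝓖 renaming (sym to ≈-sym; trans to ≈-trans)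
  open import Algebra.Properties.Group 𝓖 using (∙-cancelʳ)

  -- Induction from 0 in both directions; the downward step cancels the common difference `D x`,
  -- hence the group. It is applied to values in ℤ and in ℚ.
  ≗-by-differences : {F F′ D : ℤ → Carrier} → F 0ℤ ≈ F′ 0ℤ →
    (∀ x → F (ℤ.suc x) ≈ F x ∙ D x) → (∀ x → F′ (ℤ.suc x) ≈ F′ x ∙ D x) → ∀ x → F x ≈ F′ x
  ≗-by-differences {F} {F′} {D} base step step′ = go
    where
    up : ∀ x → F x ≈ F′ x → F (ℤ.suc x) ≈ F′ (ℤ.suc x)
    up x e = ≈-trans (step x) (≈-trans (∙-congʳ e) (≈-sym (step′ x)))
    down : ∀ x → F (ℤ.suc x) ≈ F′ (ℤ.suc x) → F x ≈ F′ x
    down x e = ∙-cancelʳ (D x) _ _ (≈-trans (≈-sym (step x)) (≈-trans e (step′ x)))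
    go : ∀ x → F x ≈ F′ x
    go (+ zero)       = base
    go (+ suc n)      = up (+ n) (go (+ n))
    go -[1+ zero ]    = down -1ℤ base
    go -[1+ suc n ]   = down -[1+ suc n ] (go -[1+ n ])

-- The discrete antiderivative of G with value c at 0. On negative arguments it subtracts, so that
-- the difference equation `∫-suc` holds on all of ℤ.
∫ : ℤ → (ℤ → ℤ) → ℤ → ℤ
∫ c G (+ zero)       = c
∫ c G (+ suc n)      = ∫ c G (+ n) + G (+ n)
∫ c G -[1+ zero ]    = c ℤ.- G -1ℤ
∫ c G -[1+ suc n ]   = ∫ c G -[1+ n ] ℤ.- G -[1+ suc n ]

[x-y]+y≡x : ∀ x y → x ℤ.- y + y ≡ x
[x-y]+y≡x = solve-∀

∫-suc : ∀ c G x → ∫ c G (ℤ.suc x) ≡ ∫ c G x + G x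
∫-suc c G (+ n)          = refl
∫-suc c G -[1+ zero ]    = sym ([x-y]+y≡x c _)
∫-suc c G -[1+ suc n ]   = sym ([x-y]+y≡x (∫ c G -[1+ n ]) _)

∫-unique : ∀ c G (F : ℤ → ℤ) → F 0ℤ ≡ c → (∀ x → F (ℤ.suc x) ≡ F x + G x) → F ≗ ∫ c G
∫-unique c G F base step = Differences.≗-by-differences (AbelianGroup.group ℤ.+-0-abelianGroup) base step (∫-suc c G)

∫-cong : ∀ {c d G H} → c ≡ d → G ≗ H → ∫ c G ≗ ∫ d H
∫-cong {c} {d} {G} {H} c≡d G≗H = ∫-unique d H (∫ c G) c≡d
  λ x → trans (∫-suc c G x) (cong (_+_ (∫ c G x)) (G≗H x))

-- The list cs stands for the polynomial Σₖ csₖ C(x,k).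
evalᵇ : List ℤ → ℤ → ℤ
evalᵇ []       x = 0ℤ
evalᵇ (c ∷ cs)   = ∫ c (evalᵇ cs)

Polynomialᵇ : (ℤ → ℤ) → Set
Polynomialᵇ F = ∃ λ cs → evalᵇ cs ≗ F

addᵇ : List ℤ → List ℤ → List ℤ
addᵇ []       ds       = ds
addᵇ (c ∷ cs) []       = c ∷ cs
addᵇ (c ∷ cs) (d ∷ ds) = c + d ∷ addᵇ cs ds

evalᵇ-add : ∀ cs ds x → evalᵇ (addᵇ cs ds) x ≡ evalᵇ cs x + evalᵇ ds x
evalᵇ-add []       ds       x = sym (ℤ.+-identityˡ _)
evalᵇ-add (c ∷ cs) []       x = sym (ℤ.+-identityʳ _)
evalᵇ-add (c ∷ cs) (d ∷ ds) x = sym (∫-unique (c + d) _ (λ x → ∫ c _ x + ∫ d _ x) refl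
  (λ x → trans (cong₂ _+_ (∫-suc c _ x) (∫-suc d _ x))
    (trans (+-interchange (∫ c _ x) (evalᵇ cs x) _ _)
      (cong (_+_ (∫ c _ x + ∫ d _ x)) (sym (evalᵇ-add cs ds x))))) x)

evalᵇ-scale : ∀ a cs x → evalᵇ (map (a *_) cs) x ≡ a * evalᵇ cs x
evalᵇ-scale a []       x = sym (ℤ.*-zeroʳ a)
evalᵇ-scale a (c ∷ cs) x = sym (∫-unique (a * c) _ (λ x → a * ∫ c _ x) refl
  (λ x → trans (cong (a *_) (∫-suc c _ x)) (trans (ℤ.*-distribˡ-+ a _ _)
    (cong (_+_ (a * ∫ c _ x)) (sym (evalᵇ-scale a cs x))))) x)

-- The antiderivative of C(x,k) that vanishes at 0 is C(x,k+1), so antiderivation only shifts the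
-- coefficients. This is the reason for working in the binomial basis.
polynomialᵇ-∫ : ∀ c {G} → Polynomialᵇ G → Polynomialᵇ (∫ c G)
polynomialᵇ-∫ c (cs , cs≗G) = c ∷ cs , ∫-cong refl cs≗G

polynomialᵇ-∑ : (xs : List A) (a : A → ℤ) {F : A → ℤ → ℤ} → (∀ x → Polynomialᵇ (F x)) →
  Polynomialᵇ (λ t → ∑ xs (λ x → a x * F x t))
polynomialᵇ-∑ []       a Fᵇ = [] , λ _ → refl
polynomialᵇ-∑ (x ∷ xs) a {F} Fᵇ with Fᵇ x | polynomialᵇ-∑ xs a Fᵇ
... | cs , cs≗ | ds , ds≗ = addᵇ (map (a x *_) cs) ds , λ t →
  trans (evalᵇ-add (map (a x *_) cs) ds t)
    (cong₂ _+_ (trans (evalᵇ-scale (a x) cs t) (cong (a x *_) (cs≗ t))) (ds≗ t))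

-- From the binomial basis to rational coefficient lists

addᵖ : Polynomial → Polynomial → Polynomial
addᵖ []       q        = q
addᵖ (a ∷ p)  []       = a ∷ p
addᵖ (a ∷ p)  (b ∷ q)  = a ℚ.+ b ∷ addᵖ p q

open +-*-Solver using (solve; _:=_; _:+_; _:*_; :-_; _:-_; con)

eval-add : ∀ p q x → eval (addᵖ p q) x ≡ eval p x ℚ.+ eval q x
eval-add []      q       x = sym (ℚ.+-identityˡ _)
eval-add (a ∷ p) []      x = sym (ℚ.+-identityʳ _)
eval-add (a ∷ p) (b ∷ q) x = trans (cong (λ r → a ℚ.+ b ℚ.+ fromℤ x ℚ.* r) (eval-add p q x))
  (solve 5 (λ a b t u v → a :+ b :+ t :* (u :+ v) := a :+ t :* u :+ (b :+ t :* v)) refl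
    a b (fromℤ x) (eval p x) (eval q x))

eval-scale : ∀ a p x → eval (map (a ℚ.*_) p) x ≡ a ℚ.* eval p x
eval-scale a []      x = sym (ℚ.*-zeroʳ a)
eval-scale a (b ∷ p) x = trans (cong (λ r → a ℚ.* b ℚ.+ fromℤ x ℚ.* r) (eval-scale a p x))
  (solve 4 (λ a b t u → a :* b :+ t :* (a :* u) := a :* (b :+ t :* u)) refl a b (fromℤ x) (eval p x))

-- The polynomial C(x,k), from C(x,k+1) = (x - k) C(x,k) / (k+1).
binomial : ℕ → Polynomial
binomial zero    = 1ℚ ∷ []
binomial (suc k) = map ((1ℤ ℚ./ suc k) ℚ.*_)
  (addᵖ (0ℚ ∷ binomial k) (map ((ℚ.- fromℤ (+ k)) ℚ.*_) (binomial k)))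

eval-binomial-suc : ∀ k x → eval (binomial (suc k)) x ≡
  (1ℤ ℚ./ suc k) ℚ.* ((fromℤ x ℚ.- fromℤ (+ k)) ℚ.* eval (binomial k) x)
eval-binomial-suc k x = trans (eval-scale (1ℤ ℚ./ suc k) (addᵖ (0ℚ ∷ binomial k) shifted) x)
  (cong ((1ℤ ℚ./ suc k) ℚ.*_) (trans (eval-add (0ℚ ∷ binomial k) shifted x)
    (trans (cong (0ℚ ℚ.+ fromℤ x ℚ.* eval (binomial k) x ℚ.+_) (eval-scale (ℚ.- fromℤ (+ k)) (binomial k) x))
      (solve 3 (λ t j b → con 0ℚ :+ t :* b :+ (:- j) :* b := (t :- j) :* b) refl
        (fromℤ x) (fromℤ (+ k)) (eval (binomial k) x)))))
  where shifted = map ((ℚ.- fromℤ (+ k)) ℚ.*_) (binomial k)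

1/suc-inverse : ∀ k → (1ℤ ℚ./ suc k) ℚ.* fromℤ (+ suc k) ≡ 1ℚ
1/suc-inverse k = ℚ.toℚᵘ-injective (begin
  ℚ.toℚᵘ ((1ℤ ℚ./ suc k) ℚ.* fromℤ (+ suc k))         ≈⟨ ℚ.toℚᵘ-homo-* (1ℤ ℚ./ suc k) _ ⟩
  ℚ.toℚᵘ (1ℤ ℚ./ suc k) ℚᵘ.* ℚ.toℚᵘ (fromℤ (+ suc k)) ≈⟨ ℚᵘ.*-cong (ℚ.toℚᵘ-fromℚᵘ (ℚᵘ.mkℚᵘ 1ℤ k)) (toℚᵘ-fromℤ (+ suc k)) ⟩
  ℚᵘ.mkℚᵘ 1ℤ k ℚᵘ.* ℚᵘ.mkℚᵘ (+ suc k) 0               ≈⟨ ℚᵘ.*≡* (cross (+ suc k)) ⟩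
  ℚᵘ.1ℚᵘ                                              ∎)
  where
  open import Relation.Binary.Reasoning.Setoid ℚᵘ.≃-setoid
  cross : ∀ x → 1ℤ * x * 1ℤ ≡ 1ℤ * (x * 1ℤ)
  cross = solve-∀

eval-binomial-zero : ∀ k → eval (binomial (suc k)) 0ℤ ≡ 0ℚ
eval-binomial-zero zero    = refl
eval-binomial-zero (suc k) = trans (eval-binomial-suc (suc k) 0ℤ)
  (trans (cong (λ b → (1ℤ ℚ./ suc (suc k)) ℚ.* ((fromℤ 0ℤ ℚ.- fromℤ (+ suc k)) ℚ.* b)) (eval-binomial-zero k))
    (solve 2 (λ r t → r :* (t :* con 0ℚ) := con 0ℚ) refl (1ℤ ℚ./ suc (suc k)) (fromℤ 0ℤ ℚ.- fromℤ (+ suc k))))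

-- Induction from the product formula. With `b₁`, `b₀` the values of C(x,j+1) and C(x,j), the
-- identity (x-j) b₀ = (j+1) b₁ turns what exceeds the first summand into (j+2) b₁, and the factor
-- 1/(j+2) leaves `b₁`.
pascal : ∀ k x → eval (binomial (suc k)) (ℤ.suc x) ≡ eval (binomial (suc k)) x ℚ.+ eval (binomial k) x
pascal zero x = begin
  eval (binomial 1) (ℤ.suc x)                         ≡⟨ eval-binomial-suc 0 (ℤ.suc x) ⟩
  1ℚ ℚ.* ((fromℤ (ℤ.suc x) ℚ.- 0ℚ) ℚ.* eval (binomial 0) (ℤ.suc x))
    ≡⟨ cong₂ (λ t b → 1ℚ ℚ.* ((t ℚ.- 0ℚ) ℚ.* b)) (fromℤ-+ 1ℤ x) (one (ℤ.suc x)) ⟩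
  1ℚ ℚ.* ((1ℚ ℚ.+ fromℤ x ℚ.- 0ℚ) ℚ.* 1ℚ)
    ≡⟨ solve 1 (λ t → con 1ℚ :* ((con 1ℚ :+ t :- con 0ℚ) :* con 1ℚ)
         := con 1ℚ :* ((t :- con 0ℚ) :* con 1ℚ) :+ con 1ℚ) refl (fromℤ x) ⟩
  1ℚ ℚ.* ((fromℤ x ℚ.- 0ℚ) ℚ.* 1ℚ) ℚ.+ 1ℚ
    ≡⟨ cong₂ (λ b c → 1ℚ ℚ.* ((fromℤ x ℚ.- 0ℚ) ℚ.* b) ℚ.+ c) (one x) (one x) ⟨
  1ℚ ℚ.* ((fromℤ x ℚ.- 0ℚ) ℚ.* eval (binomial 0) x) ℚ.+ eval (binomial 0) x
    ≡⟨ cong (ℚ._+ eval (binomial 0) x) (eval-binomial-suc 0 x) ⟨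
  eval (binomial 1) x ℚ.+ eval (binomial 0) x         ∎
  where
  open ≡-Reasoning
  one : ∀ x → eval (binomial 0) x ≡ 1ℚ
  one x = solve 1 (λ t → con 1ℚ :+ t :* con 0ℚ := con 1ℚ) refl (fromℤ x)
pascal (suc j) x = begin
  eval (binomial (2+ j)) (ℤ.suc x)
    ≡⟨ eval-binomial-suc (suc j) (ℤ.suc x) ⟩
  r ℚ.* ((fromℤ (ℤ.suc x) ℚ.- K) ℚ.* eval (binomial (suc j)) (ℤ.suc x))
    ≡⟨ cong₂ (λ t b → r ℚ.* ((t ℚ.- K) ℚ.* b)) (fromℤ-+ 1ℤ x) (pascal j x) ⟩
  r ℚ.* ((1ℚ ℚ.+ X ℚ.- K) ℚ.* (b₁ ℚ.+ b₀))
    ≡⟨ cong (λ k → r ℚ.* ((1ℚ ℚ.+ X ℚ.- k) ℚ.* (b₁ ℚ.+ b₀))) (fromℤ-+ 1ℤ (+ j)) ⟩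
  r ℚ.* ((1ℚ ℚ.+ X ℚ.- (1ℚ ℚ.+ J)) ℚ.* (b₁ ℚ.+ b₀))
    ≡⟨ solve 5 (λ r X J b₁ b₀ → r :* ((con 1ℚ :+ X :- (con 1ℚ :+ J)) :* (b₁ :+ b₀))
         := r :* ((X :- (con 1ℚ :+ J)) :* b₁) :+ r :* (b₁ :+ (X :- J) :* b₀)) refl r X J b₁ b₀ ⟩
  r ℚ.* ((X ℚ.- (1ℚ ℚ.+ J)) ℚ.* b₁) ℚ.+ r ℚ.* (b₁ ℚ.+ (X ℚ.- J) ℚ.* b₀)
    ≡⟨ cong₂ (λ k c → r ℚ.* ((X ℚ.- k) ℚ.* b₁) ℚ.+ r ℚ.* (b₁ ℚ.+ c)) (sym (fromℤ-+ 1ℤ (+ j))) absorb ⟩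
  r ℚ.* ((X ℚ.- K) ℚ.* b₁) ℚ.+ r ℚ.* (b₁ ℚ.+ K ℚ.* b₁)
    ≡⟨ cong₂ ℚ._+_ (sym (eval-binomial-suc (suc j) x)) cancel ⟩
  eval (binomial (2+ j)) x ℚ.+ b₁ ∎
  where
  open ≡-Reasoning
  2+ : ℕ → ℕ
  2+ j = suc (suc j)
  r = 1ℤ ℚ./ suc (suc j)
  r′ = 1ℤ ℚ./ suc j
  X = fromℤ x
  J = fromℤ (+ j)
  K = fromℤ (+ suc j)
  b₁ = eval (binomial (suc j)) x
  b₀ = eval (binomial j) x
  absorb : (X ℚ.- J) ℚ.* b₀ ≡ K ℚ.* b₁
  absorb = sym (begin
    K ℚ.* b₁                            ≡⟨ cong (K ℚ.*_) (eval-binomial-suc j x) ⟩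
    K ℚ.* (r′ ℚ.* ((X ℚ.- J) ℚ.* b₀))   ≡⟨ solve 3 (λ K r t → K :* (r :* t) := r :* K :* t) refl K r′ ((X ℚ.- J) ℚ.* b₀) ⟩
    r′ ℚ.* K ℚ.* ((X ℚ.- J) ℚ.* b₀)     ≡⟨ cong (ℚ._* ((X ℚ.- J) ℚ.* b₀)) (1/suc-inverse j) ⟩
    1ℚ ℚ.* ((X ℚ.- J) ℚ.* b₀)           ≡⟨ ℚ.*-identityˡ _ ⟩
    (X ℚ.- J) ℚ.* b₀                    ∎)
  cancel : r ℚ.* (b₁ ℚ.+ K ℚ.* b₁) ≡ b₁
  cancel = begin
    r ℚ.* (b₁ ℚ.+ K ℚ.* b₁)        ≡⟨ solve 3 (λ r b₁ K → r :* (b₁ :+ K :* b₁) := r :* (con 1ℚ :+ K) :* b₁) refl r b₁ K ⟩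
    r ℚ.* (1ℚ ℚ.+ K) ℚ.* b₁       ≡⟨ cong (λ k → r ℚ.* k ℚ.* b₁) (fromℤ-+ 1ℤ (+ suc j)) ⟨
    r ℚ.* fromℤ (+ 2+ j) ℚ.* b₁   ≡⟨ cong (ℚ._* b₁) (1/suc-inverse (suc j)) ⟩
    1ℚ ℚ.* b₁                     ≡⟨ ℚ.*-identityˡ b₁ ⟩
    b₁                            ∎

-- The offset k is the index of the first binomial coefficient. It is there so that the difference
-- operator has a name: by Pascal's rule it lowers the offset by one, see `eval-fromBinomial-suc`.
fromBinomial : ℕ → List ℤ → Polynomial
fromBinomial k []       = []
fromBinomial k (c ∷ cs) = addᵖ (map (fromℤ c ℚ.*_) (binomial k)) (fromBinomial (suc k) cs)

eval-fromBinomial-∷ : ∀ k c cs x → eval (fromBinomial k (c ∷ cs)) x ≡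
  fromℤ c ℚ.* eval (binomial k) x ℚ.+ eval (fromBinomial (suc k) cs) x
eval-fromBinomial-∷ k c cs x = trans (eval-add (map (fromℤ c ℚ.*_) (binomial k)) _ x)
  (cong (ℚ._+ _) (eval-scale (fromℤ c) (binomial k) x))

eval-fromBinomial-zero : ∀ k cs → eval (fromBinomial (suc k) cs) 0ℤ ≡ 0ℚ
eval-fromBinomial-zero k []       = refl
eval-fromBinomial-zero k (c ∷ cs) = trans (eval-fromBinomial-∷ (suc k) c cs 0ℤ)
  (trans (cong₂ (λ b r → fromℤ c ℚ.* b ℚ.+ r) (eval-binomial-zero k) (eval-fromBinomial-zero (suc k) cs))
    (solve 1 (λ c → c :* con 0ℚ :+ con 0ℚ := con 0ℚ) refl (fromℤ c)))

eval-fromBinomial-suc : ∀ k cs x → eval (fromBinomial (suc k) cs) (ℤ.suc x) ≡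
  eval (fromBinomial (suc k) cs) x ℚ.+ eval (fromBinomial k cs) x
eval-fromBinomial-suc k []       x = refl
eval-fromBinomial-suc k (c ∷ cs) x = begin
  eval (fromBinomial (suc k) (c ∷ cs)) (ℤ.suc x)
    ≡⟨ eval-fromBinomial-∷ (suc k) c cs (ℤ.suc x) ⟩
  fromℤ c ℚ.* eval (binomial (suc k)) (ℤ.suc x) ℚ.+ eval (fromBinomial (suc (suc k)) cs) (ℤ.suc x)
    ≡⟨ cong₂ (λ b r → fromℤ c ℚ.* b ℚ.+ r) (pascal k x) (eval-fromBinomial-suc (suc k) cs x) ⟩
  fromℤ c ℚ.* (b₁ ℚ.+ b₀) ℚ.+ (r₁ ℚ.+ r₀)
    ≡⟨ solve 5 (λ c b₁ b₀ r₁ r₀ → c :* (b₁ :+ b₀) :+ (r₁ :+ r₀) := c :* b₁ :+ r₁ :+ (c :* b₀ :+ r₀)) refl (fromℤ c) b₁ b₀ r₁ r₀ ⟩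
  fromℤ c ℚ.* b₁ ℚ.+ r₁ ℚ.+ (fromℤ c ℚ.* b₀ ℚ.+ r₀)
    ≡⟨ cong₂ ℚ._+_ (eval-fromBinomial-∷ (suc k) c cs x) (eval-fromBinomial-∷ k c cs x) ⟨
  eval (fromBinomial (suc k) (c ∷ cs)) x ℚ.+ eval (fromBinomial k (c ∷ cs)) x ∎
  where
  open ≡-Reasoning
  b₁ = eval (binomial (suc k)) x
  b₀ = eval (binomial k) x
  r₁ = eval (fromBinomial (suc (suc k)) cs) x
  r₀ = eval (fromBinomial (suc k) cs) x

-- Both sides have the value c at 0 and, by induction on the list, the same differences `evalᵇ cs`;
-- so they agree on all of ℤ, negative integers included.
eval-fromBinomial : ∀ cs x → eval (fromBinomial 0 cs) x ≡ fromℤ (evalᵇ cs x)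
eval-fromBinomial []       x = refl
eval-fromBinomial (c ∷ cs) x = Differences.≗-by-differences ℚ.+-0-group
  base step (λ x → trans (cong fromℤ (∫-suc c _ x)) (fromℤ-+ (evalᵇ (c ∷ cs) x) _)) x
  where
  E : ∀ x → eval (fromBinomial 0 (c ∷ cs)) x ≡ fromℤ c ℚ.+ eval (fromBinomial 1 cs) x
  E x = trans (eval-fromBinomial-∷ 0 c cs x)
    (solve 3 (λ c t r → c :* (con 1ℚ :+ t :* con 0ℚ) :+ r := c :+ r) refl (fromℤ c) (fromℤ x) (eval (fromBinomial 1 cs) x))
  base : eval (fromBinomial 0 (c ∷ cs)) 0ℤ ≡ fromℤ c
  base = trans (E 0ℤ) (trans (cong (fromℤ c ℚ.+_) (eval-fromBinomial-zero 0 cs)) (ℚ.+-identityʳ _))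
  step : ∀ x → eval (fromBinomial 0 (c ∷ cs)) (ℤ.suc x) ≡ eval (fromBinomial 0 (c ∷ cs)) x ℚ.+ fromℤ (evalᵇ cs x)
  step x = begin
    eval (fromBinomial 0 (c ∷ cs)) (ℤ.suc x)
      ≡⟨ E (ℤ.suc x) ⟩
    fromℤ c ℚ.+ eval (fromBinomial 1 cs) (ℤ.suc x)
      ≡⟨ cong (fromℤ c ℚ.+_) (eval-fromBinomial-suc 0 cs x) ⟩
    fromℤ c ℚ.+ (eval (fromBinomial 1 cs) x ℚ.+ eval (fromBinomial 0 cs) x)
      ≡⟨ ℚ.+-assoc (fromℤ c) _ _ ⟨
    fromℤ c ℚ.+ eval (fromBinomial 1 cs) x ℚ.+ eval (fromBinomial 0 cs) x
      ≡⟨ cong₂ ℚ._+_ (sym (E x)) (eval-fromBinomial cs x) ⟩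
    eval (fromBinomial 0 (c ∷ cs)) x ℚ.+ fromℤ (evalᵇ cs x) ∎
    where open ≡-Reasoning

-- Order polynomials

∈─⁻ : {p q : Subset m} {x : Fin m} → x ∈ p ─ q → x ∈ p × x ∉ q
∈─⁻ {p = p} {q} x∈ = p─q⊆p p q x∈ , ∉q p q x∈
  where
  ∉q : (p q : Subset m) {x : Fin m} → x ∈ p ─ q → x ∉ q
  ∉q (_ ∷ p) (inside ∷ q) ()         here
  ∉q (_ ∷ p) (_ ∷ q)      (there x∈) (there x∈q) = ∉q p q x∈ x∈q

≢⊥⇒Nonempty : {p : Subset m} → p ≢ ⊥ → Nonempty p
≢⊥⇒Nonempty {p = p} p≢⊥ with nonempty? p
... | yes ne = ne
... | no ¬ne = contradiction (Empty-unique ¬ne) p≢⊥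

[p∪q]─q≡p : {p q : Subset m} → (∀ {x} → x ∈ q → x ∉ p) → (p ∪ q) ─ q ≡ p
[p∪q]─q≡p {p = p} {q} disj = ⊆-antisym to (λ x∈p → x∈p∧x∉q⇒x∈p─q (p⊆p∪q q x∈p) (λ x∈q → disj x∈q x∈p))
  where
  to : (p ∪ q) ─ q ⊆ p
  to x∈ with ∈─⁻ {p = p ∪ q} x∈
  ... | x∈p∪q , x∉q with x∈p∪q⁻ p q x∈p∪q
  ...   | inj₁ x∈p = x∈p
  ...   | inj₂ x∈q = contradiction x∈q x∉q

[p─q]∪q≡p : {p q : Subset m} → q ⊆ p → (p ─ q) ∪ q ≡ p
[p─q]∪q≡p {p = p} {q} q⊆p = ⊆-antisym to from
  where
  to : (p ─ q) ∪ q ⊆ p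
  to x∈ with x∈p∪q⁻ (p ─ q) q x∈
  ... | inj₁ x∈p─q = p─q⊆p p q x∈p─q
  ... | inj₂ x∈q   = q⊆p x∈q
  from : p ⊆ (p ─ q) ∪ q
  from {x} x∈p with x ∈? q
  ... | yes x∈q = q⊆p∪q (p ─ q) q x∈q
  ... | no x∉q  = p⊆p∪q q (x∈p∧x∉q⇒x∈p─q x∈p x∉q)

sgn : Subset m → ℤ
sgn []            = 1ℤ
sgn (outside ∷ p) = sgn p
sgn (inside ∷ p)  = - sgn p

sgn-⊥ : ∀ m → sgn (⊥ {m}) ≡ 1ℤ
sgn-⊥ zero    = refl
sgn-⊥ (suc m) = sgn-⊥ m

sgn-⊤ : ∀ m → sgn (⊤ {m}) ≡ -1ℤ ℤ.^ m
sgn-⊤ zero    = refl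
sgn-⊤ (suc m) = trans (cong -_ (sgn-⊤ m)) (sym (ℤ.-1*i≡-i _))

sgn-─ : {p q : Subset m} → q ⊆ p → sgn (p ─ q) ≡ sgn p * sgn q
sgn-─ {p = []}          {[]}          q⊆p = refl
sgn-─ {p = outside ∷ p} {outside ∷ q} q⊆p = sgn-─ {p = p} {q} (drop-∷-⊆ q⊆p)
sgn-─ {p = inside ∷ p}  {outside ∷ q} q⊆p =
  trans (cong -_ (sgn-─ {p = p} {q} (drop-∷-⊆ q⊆p))) (ℤ.neg-distribˡ-* (sgn p) (sgn q))
sgn-─ {p = inside ∷ p}  {inside ∷ q}  q⊆p =
  trans (sgn-─ {p = p} {q} (drop-∷-⊆ q⊆p)) (negneg (sgn p) (sgn q))
  where
  negneg : ∀ a b → a * b ≡ (- a) * (- b)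
  negneg = solve-∀
sgn-─ {p = outside ∷ p} {inside ∷ q}  q⊆p with () ← q⊆p here

toggle : Fin m → Subset m → Subset m
toggle v p = Vec.updateAt p v not

toggle-involutive : (v : Fin m) (p : Subset m) → toggle v (toggle v p) ≡ p
toggle-involutive zero    (s ∷ p) = cong (_∷ p) (Bool.not-involutive s)
toggle-involutive (suc v) (s ∷ p) = cong (s ∷_) (toggle-involutive v p)

sgn-toggle : (v : Fin m) (p : Subset m) → sgn (toggle v p) ≡ - sgn p
sgn-toggle zero    (outside ∷ p) = refl
sgn-toggle zero    (inside ∷ p)  = sym (ℤ.neg-involutive (sgn p))
sgn-toggle (suc v) (outside ∷ p) = sgn-toggle v p
sgn-toggle (suc v) (inside ∷ p)  = cong -_ (sgn-toggle v p)

∈-toggle⁻ : {u v : Fin m} {p : Subset m} → u ≢ v → u ∈ toggle v p → u ∈ p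
∈-toggle⁻ {u = u} {v} {p} u≢v u∈ =
  subst (u ∈_) (toggle-involutive v p) (Vec.updateAt-minimal u v (toggle v p) u≢v u∈)

i≡-i⇒i≡0 : ∀ {i} → i ≡ - i → i ≡ 0ℤ
i≡-i⇒i≡0 {+ zero} _ = refl

𝟙*≢0 : (p? : Dec P) {x : ℤ} → 𝟙 p? * x ≢ 0ℤ → P × x ≢ 0ℤ
𝟙*≢0 (yes p) h = p , λ { refl → h refl }
𝟙*≢0 (no _)  h = contradiction refl h

module OrderPolynomial {m : ℕ} {R : Fin m → Fin m → Set} (R? : ∀ u v → Dec (R u v)) where

  𝓢 : Finite (Subset m)
  𝓢 = subsetFinite m

  -- T can be the set of vertices of lowest color when A is the set of all
  -- vertices, colors weakly (w = true) or strictly (w = false) increase along R.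
  Step : Bool → (A T : Subset m) → Set
  Step w A S = S ⊆ A × (∀ u v → R u v → u ∈ A → v ∈ S → T w × u ∈ S)

  step? : ∀ w A S → Dec (Step w A S)
  step? w A S = (S ⊆? A) ×-dec Fin.all? λ u → Fin.all? λ v →
    R? u v →-dec ((u ∈? A) →-dec ((v ∈? S) →-dec (Bool.T? w ×-dec (u ∈? S))))

  -- The color classes, lowest color first, of an increasing coloring of A with n colors; each class
  -- is a step from the vertices that remain.
  Chain : Bool → Subset m → Vec (Subset m) n → Set
  Chain w A []       = A ≡ ⊥
  Chain w A (S ∷ Ss) = Step w A S × Chain w (A ─ S) Ss

  chain? : ∀ w A (Ss : Vec (Subset m) n) → Dec (Chain w A Ss)
  chain? w A []       = A ≟ˢ ⊥
  chain? w A (S ∷ Ss) = step? w A S ×-dec chain? w (A ─ S) Ss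

  chains : Bool → Subset m → ℕ → ℤ
  chains w A n = sum (vecFinite 𝓢 n) (λ Ss → 𝟙 (chain? w A Ss))

  chains-zero : ∀ w A → chains w A 0 ≡ 𝟙 (A ≟ˢ ⊥)
  chains-zero w A = ℤ.+-identityʳ _

  chains-suc : ∀ w A n → chains w A (suc n) ≡ sum 𝓢 (λ S → 𝟙 (step? w A S) * chains w (A ─ S) n)
  chains-suc w A n = trans (sum-∷ {n = n} 𝓢 _) (∑-cong (Finite.elems 𝓢) λ S →
    trans (∑-cong (Finite.elems (vecFinite 𝓢 n)) λ Ss → 𝟙-× (step? w A S) (chain? w (A ─ S) Ss))
      (∑-*ˡ (Finite.elems (vecFinite 𝓢 n)) (𝟙 (step? w A S)) (λ Ss → 𝟙 (chain? w (A ─ S) Ss))))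

  -- With fuel L > ∣ A ∣ this is the strict order polynomial of A.
  Ω-fuel : ℕ → Subset m → ℤ → ℤ
  Ω-fuel zero    A x = 0ℤ
  -- Without colors only the empty set can be colored, which gives the constant. The term with S
  -- empty would be the polynomial of A itself at x; leaving it out turns the recursion into one for
  -- the difference, over smaller sets.
  Ω-fuel (suc L) A   = ∫ (𝟙 (A ≟ˢ ⊥)) λ x →
    sum 𝓢 λ S → 𝟙 (step? false A S ×-dec ¬? (S ≟ˢ ⊥)) * Ω-fuel L (A ─ S) x

  -- The fuel `suc m` exceeds the cardinality of every A.
  Ω : Subset m → ℤ → ℤ
  Ω = Ω-fuel (suc m)

  polynomialᵇ-Ω-fuel : ∀ L A → Polynomialᵇ (Ω-fuel L A)
  polynomialᵇ-Ω-fuel zero    A = List.[] , λ _ → refl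
  polynomialᵇ-Ω-fuel (suc L) A =
    polynomialᵇ-∫ _ (polynomialᵇ-∑ (Finite.elems 𝓢)
      (λ S → 𝟙 (step? false A S ×-dec ¬? (S ≟ˢ ⊥))) (λ S → polynomialᵇ-Ω-fuel L (A ─ S)))

  nonempty-step-shrinks : ∀ {w A S} → Step w A S → S ≢ ⊥ → ∣ A ─ S ∣ ℕ.< ∣ A ∣
  nonempty-step-shrinks {A = A} {S} (S⊆A , _) S≢⊥ with ≢⊥⇒Nonempty S≢⊥
  ... | x , x∈S = p∩q≢∅⇒∣p─q∣<∣p∣ A S (x , x∈p∩q⁺ (S⊆A x∈S , x∈S))

  Ω-fuel-stable : ∀ L A → ∣ A ∣ ℕ.< L → Ω-fuel (suc L) A ≗ Ω-fuel L A
  Ω-fuel-stable (suc L) A (s≤s ∣A∣≤L) = ∫-cong refl λ x → ∑-cong (Finite.elems 𝓢) λ S →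
    𝟙*-cong (step? false A S ×-dec ¬? (S ≟ˢ ⊥)) λ (st , S≢⊥) →
      Ω-fuel-stable L (A ─ S) (ℕ.<-≤-trans (nonempty-step-shrinks {w = false} {A} st S≢⊥) ∣A∣≤L) x

  -- The term with S empty is the summand `Ω A x` of `∫-suc`. The other terms of the difference
  -- carry only fuel m, which still suffices because a nonempty step leaves fewer than m vertices.
  Ω-suc : ∀ A x → Ω A (ℤ.suc x) ≡ sum 𝓢 (λ S → 𝟙 (step? false A S) * Ω (A ─ S) x)
  Ω-suc A x = begin
    Ω A (ℤ.suc x)
      ≡⟨ ∫-suc _ _ x ⟩
    Ω A x + sum 𝓢 rest
      ≡⟨ cong (_+ sum 𝓢 rest) (sum-delta 𝓢 ⊥ (λ _ → Ω A x)) ⟨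
    sum 𝓢 (λ S → 𝟙 (S ≟ˢ ⊥) * Ω A x) + sum 𝓢 rest
      ≡⟨ ∑-+ (Finite.elems 𝓢) _ _ ⟨
    sum 𝓢 (λ S → 𝟙 (S ≟ˢ ⊥) * Ω A x + rest S)
      ≡⟨ ∑-cong (Finite.elems 𝓢) split ⟨
    sum 𝓢 (λ S → 𝟙 (step? false A S) * Ω (A ─ S) x) ∎
    where
    open ≡-Reasoning
    rest : Subset m → ℤ
    rest S = 𝟙 (step? false A S ×-dec ¬? (S ≟ˢ ⊥)) * Ω-fuel m (A ─ S) x
    split : ∀ S → 𝟙 (step? false A S) * Ω (A ─ S) x ≡ 𝟙 (S ≟ˢ ⊥) * Ω A x + rest S
    split S = go (S ≟ˢ ⊥)
      where
      go : Dec (S ≡ ⊥) → 𝟙 (step? false A S) * Ω (A ─ S) x ≡ 𝟙 (S ≟ˢ ⊥) * Ω A x + rest S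
      go (yes refl) = trans
        (cong₂ (λ i B → i * Ω B x)
          (𝟙-yes (step? false A ⊥) (⊆-min A , λ u v _ _ v∈⊥ → contradiction v∈⊥ ∉⊥)) (p─⊥≡p A))
        (sym (trans
          (cong₂ (λ i j → i * Ω A x + j * Ω-fuel m (A ─ ⊥) x) (𝟙-yes (⊥ {m} ≟ˢ ⊥) refl)
            (𝟙-no (step? false A ⊥ ×-dec ¬? (⊥ {m} ≟ˢ ⊥)) (λ (_ , ⊥≢⊥) → ⊥≢⊥ refl)))
          (ℤ.+-identityʳ _)))
      go (no S≢⊥) = trans
        (trans
          (𝟙*-cong (step? false A S) (λ st → Ω-fuel-stable m (A ─ S)
            (ℕ.<-≤-trans (nonempty-step-shrinks {w = false} {A} st S≢⊥) (∣p∣≤n A)) x))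
          (cong (_* Ω-fuel m (A ─ S) x)
            (𝟙-cong (step? false A S) (step? false A S ×-dec ¬? (S ≟ˢ ⊥)) (_, S≢⊥) proj₁)))
        (sym (trans (cong (λ i → i * Ω A x + rest S) (𝟙-no (S ≟ˢ ⊥) S≢⊥)) (ℤ.+-identityˡ _)))

  strict-chains : ∀ A n → chains false A n ≡ Ω A (+ n)
  strict-chains A zero    = chains-zero false A
  strict-chains A (suc n) = trans (chains-suc false A n) (trans
    (∑-cong (Finite.elems 𝓢) λ S → cong (𝟙 (step? false A S) *_) (strict-chains (A ─ S) n))
    (sym (Ω-suc A (+ n))))

  -- For a relation on a finite set this is acyclicity, in the form that hands the involution a
  -- vertex to move.
  HasSinks : Set
  HasSinks = ∀ V → Nonempty V → ∃ λ v → v ∈ V × (∀ w → w ∈ V → ¬ R v w)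

  -- V = U ∪ S for a weak step U from A followed by a strict step S from A ─ U.
  DoubleStep : (A V S : Subset m) → Set
  DoubleStep A V S = S ⊆ V × V ⊆ A × (∀ u w → R u w → u ∈ A → w ∈ V → u ∈ V × u ∉ S)

  doubleStep? : ∀ A V S → Dec (DoubleStep A V S)
  doubleStep? A V S = (S ⊆? V) ×-dec (V ⊆? A) ×-dec Fin.all? λ u → Fin.all? λ w →
    R? u w →-dec ((u ∈? A) →-dec ((w ∈? V) →-dec ((u ∈? V) ×-dec ¬? (u ∈? S))))

  doubleStep⇒weak : ∀ {A V S} → DoubleStep A V S → Step true A (V ─ S)
  doubleStep⇒weak {A} {V} {S} (S⊆V , V⊆A , closed) = V⊆A ∘ p─q⊆p V S , λ u v Ruv u∈A v∈ →
    let u∈V , u∉S = closed u v Ruv u∈A (p─q⊆p V S v∈) in _ , x∈p∧x∉q⇒x∈p─q u∈V u∉S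

  doubleStep⇒strict : ∀ {A V S} → DoubleStep A V S → Step false (A ─ (V ─ S)) S
  doubleStep⇒strict {A} {V} {S} (S⊆V , V⊆A , closed) =
    (λ x∈S → x∈p∧x∉q⇒x∈p─q (V⊆A (S⊆V x∈S)) (λ x∈V─S → proj₂ (∈─⁻ {p = V} x∈V─S) x∈S)) ,
    λ u v Ruv u∈ v∈S →
      let u∈A , u∉V─S = ∈─⁻ {p = A} u∈
          u∈V , u∉S = closed u v Ruv u∈A (S⊆V v∈S)
      in contradiction (x∈p∧x∉q⇒x∈p─q u∈V u∉S) u∉V─S

  steps⇒doubleStep : ∀ {A U S} → Step true A U → Step false (A ─ U) S → DoubleStep A (U ∪ S) S
  steps⇒doubleStep {A} {U} {S} (U⊆A , weak) (S⊆A─U , strict) = q⊆p∪q U S , ∪⊆A , closed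
    where
    ∪⊆A : U ∪ S ⊆ A
    ∪⊆A x∈ with x∈p∪q⁻ U S x∈
    ... | inj₁ x∈U = U⊆A x∈U
    ... | inj₂ x∈S = p─q⊆p A U (S⊆A─U x∈S)
    closed : ∀ u w → R u w → u ∈ A → w ∈ U ∪ S → u ∈ U ∪ S × u ∉ S
    closed u w Ruw u∈A w∈ with x∈p∪q⁻ U S w∈ | u ∈? U
    ... | _        | yes u∈U = p⊆p∪q S u∈U , λ u∈S → proj₂ (∈─⁻ {p = A} (S⊆A─U u∈S)) u∈U
    ... | inj₁ w∈U | no u∉U  = contradiction (proj₂ (weak u w Ruw u∈A w∈U)) u∉U
    ... | inj₂ w∈S | no u∉U with () ← proj₁ (strict u w Ruw (x∈p∧x∉q⇒x∈p─q u∈A u∉U) w∈S)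

  -- Apart from `S ⊆ V`, a double step restricts S only by keeping the tails of arcs into V out of
  -- it. A sink of V is no such tail, so it may be put into S or taken out freely.
  doubleStep-toggle : ∀ {A V S v} → v ∈ V → (∀ w → w ∈ V → ¬ R v w) →
    DoubleStep A V S → DoubleStep A V (toggle v S)
  doubleStep-toggle {A} {V} {S} {v} v∈V sink (S⊆V , V⊆A , closed) = ⊆V , V⊆A , closed′
    where
    ⊆V : toggle v S ⊆ V
    ⊆V {u} u∈ with u Fin.≟ v
    ... | yes refl = v∈V
    ... | no u≢v   = S⊆V (∈-toggle⁻ u≢v u∈)
    closed′ : ∀ u w → R u w → u ∈ A → w ∈ V → u ∈ V × u ∉ toggle v S
    closed′ u w Ruw u∈A w∈V with u Fin.≟ v
    ... | yes refl = contradiction Ruw (sink w w∈V)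
    ... | no u≢v   = proj₁ (closed u w Ruw u∈A w∈V) ,
      λ u∈ → proj₂ (closed u w Ruw u∈A w∈V) (∈-toggle⁻ u≢v u∈)

  -- Toggling a sink of V in S is a sign-reversing involution.
  signed-doubleSteps : HasSinks → ∀ A V →
    sum 𝓢 (λ S → 𝟙 (doubleStep? A V S) * sgn S) ≡ 𝟙 (V ≟ˢ ⊥)
  signed-doubleSteps sinks A V with V ≟ˢ ⊥
  ... | yes refl = trans (∑-cong (Finite.elems 𝓢) λ S → cong (_* sgn S)
          (𝟙-cong (doubleStep? A ⊥ S) (S ≟ˢ ⊥)
            (λ (S⊆⊥ , _) → ⊆-antisym S⊆⊥ (⊆-min S))
            (λ { refl → id , ⊆-min A , λ u w _ _ w∈⊥ → contradiction w∈⊥ ∉⊥ })))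
          (trans (sum-delta 𝓢 ⊥ sgn) (sgn-⊥ m))
  ... | no V≢⊥ with sinks V (≢⊥⇒Nonempty V≢⊥)
  ...   | v , v∈V , sink = i≡-i⇒i≡0 (begin
    sum 𝓢 h
      ≡⟨ sum-reindex 𝓢 𝓢 (toggle v) (λ _ _ → refl)
           (λ S S′ _ _ e → trans (sym (toggle-involutive v S)) (trans (cong (toggle v) e) (toggle-involutive v S′)))
           (λ S hS≢0 → toggle v S , toggle-involutive v S ,
             subst (λ S → h S ≢ 0ℤ) (sym (toggle-involutive v S)) hS≢0) ⟩
    sum 𝓢 (h ∘ toggle v)
      ≡⟨ ∑-cong (Finite.elems 𝓢) h-toggle ⟩
    sum 𝓢 (λ S → -1ℤ * h S)
      ≡⟨ ∑-*ˡ (Finite.elems 𝓢) -1ℤ h ⟩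
    -1ℤ * sum 𝓢 h
      ≡⟨ ℤ.-1*i≡-i _ ⟩
    - sum 𝓢 h ∎)
    where
    open ≡-Reasoning
    h : Subset m → ℤ
    h S = 𝟙 (doubleStep? A V S) * sgn S
    rearrange : ∀ a b → a * (- b) ≡ -1ℤ * (a * b)
    rearrange = solve-∀
    h-toggle : ∀ S → h (toggle v S) ≡ -1ℤ * h S
    h-toggle S = trans (cong₂ _*_
      (𝟙-cong (doubleStep? A V (toggle v S)) (doubleStep? A V S)
        (λ d → subst (DoubleStep A V) (toggle-involutive v S) (doubleStep-toggle {S = toggle v S} v∈V sink d))
        (doubleStep-toggle {S = S} v∈V sink))
      (sgn-toggle v S)) (rearrange (𝟙 (doubleStep? A V S)) (sgn S))

  -- The matrix of strict steps is inverted by the signed matrix of weak steps.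
  Ω-pred : HasSinks → ∀ A x →
    sum 𝓢 (λ U → 𝟙 (step? true A U) * (sgn U * Ω (A ─ U) (ℤ.suc x))) ≡ Ω A x
  Ω-pred sinks A x = begin
    sum 𝓢 (λ U → 𝟙 (step? true A U) * (sgn U * Ω (A ─ U) (ℤ.suc x)))
      ≡⟨ ∑-cong (Finite.elems 𝓢) expand ⟩
    sum 𝓢 (λ U → sum 𝓢 λ S → k U S)
      ≡⟨ ∑-swap (Finite.elems 𝓢) (Finite.elems 𝓢) k ⟩
    sum 𝓢 (λ S → sum 𝓢 λ U → k U S)
      -- For fixed S, a weak step U followed by the strict step S corresponds to the double step
      -- with V = U ∪ S. The pair then leaves A ─ V, and the sign of U = V ─ S splits into those of
      -- V and S.
      ≡⟨ ∑-cong (Finite.elems 𝓢) (λ S → sum-reindex 𝓢 𝓢 (_─ S)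
           (λ V gV≢0 → value V S (proj₁ (𝟙*≢0 (doubleStep? A V S) gV≢0)))
           (λ V V′ gV≢0 gV′≢0 → injective S V V′ (proj₁ (𝟙*≢0 (doubleStep? A V S) gV≢0))
             (proj₁ (𝟙*≢0 (doubleStep? A V′ S) gV′≢0)))
           (λ U → surjective U S)) ⟩
    sum 𝓢 (λ S → sum 𝓢 λ V → g V S)
      ≡⟨ ∑-swap (Finite.elems 𝓢) (Finite.elems 𝓢) (λ S V → g V S) ⟩
    sum 𝓢 (λ V → sum 𝓢 λ S → g V S)
      -- The value at A ─ V does not depend on S, so the signed count of the S inside V factors out
      -- and kills every nonempty V.
      ≡⟨ ∑-cong (Finite.elems 𝓢) (λ V → trans
           (∑-cong (Finite.elems 𝓢) (λ S → regroup (𝟙 (doubleStep? A V S)) (sgn V) (sgn S) (Ω (A ─ V) x)))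
           (trans (∑-*ʳ (Finite.elems 𝓢) (λ S → 𝟙 (doubleStep? A V S) * sgn S) (sgn V * Ω (A ─ V) x)) (cong (_* (sgn V * Ω (A ─ V) x)) (signed-doubleSteps sinks A V)))) ⟩
    sum 𝓢 (λ V → 𝟙 (V ≟ˢ ⊥) * (sgn V * Ω (A ─ V) x))
      ≡⟨ sum-delta 𝓢 ⊥ (λ V → sgn V * Ω (A ─ V) x) ⟩
    sgn (⊥ {m}) * Ω (A ─ ⊥) x
      ≡⟨ cong₂ (λ s B → s * Ω B x) (sgn-⊥ m) (p─⊥≡p A) ⟩
    1ℤ * Ω A x
      ≡⟨ ℤ.*-identityˡ _ ⟩
    Ω A x ∎
    where
    open ≡-Reasoning
    k : Subset m → Subset m → ℤ
    k U S = 𝟙 (step? true A U) * (sgn U * (𝟙 (step? false (A ─ U) S) * Ω (A ─ U ─ S) x))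
    g : Subset m → Subset m → ℤ
    g V S = 𝟙 (doubleStep? A V S) * (sgn V * sgn S * Ω (A ─ V) x)
    regroup : ∀ d v s o → d * (v * s * o) ≡ d * s * (v * o)
    regroup = solve-∀
    expand : ∀ U → 𝟙 (step? true A U) * (sgn U * Ω (A ─ U) (ℤ.suc x)) ≡ sum 𝓢 (λ S → k U S)
    expand U = sym (trans (∑-*ˡ (Finite.elems 𝓢) (𝟙 (step? true A U)) _) (cong (𝟙 (step? true A U) *_)
      (trans (∑-*ˡ (Finite.elems 𝓢) (sgn U) _) (cong (sgn U *_) (sym (Ω-suc (A ─ U) x))))))
    value : ∀ V S → DoubleStep A V S → k (V ─ S) S ≡ g V S
    value V S d@(S⊆V , _) = trans
      (cong₂ (λ a b → a * (sgn (V ─ S) * (b * Ω (A ─ (V ─ S) ─ S) x)))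
        (𝟙-yes (step? true A (V ─ S)) (doubleStep⇒weak d))
        (𝟙-yes (step? false (A ─ (V ─ S)) S) (doubleStep⇒strict d)))
      (trans (cong₂ (λ s B → 1ℤ * (s * (1ℤ * Ω B x))) (sgn-─ {p = V} {S} S⊆V)
               (trans (p─q─r≡p─q∪r A (V ─ S) S) (cong (A ─_) ([p─q]∪q≡p S⊆V))))
        (trans (cong (λ y → 1ℤ * (sgn V * sgn S * y)) (ℤ.*-identityˡ _))
          (cong (_* (sgn V * sgn S * Ω (A ─ V) x)) (sym (𝟙-yes (doubleStep? A V S) d)))))
    injective : ∀ S V V′ → DoubleStep A V S → DoubleStep A V′ S → V ─ S ≡ V′ ─ S → V ≡ V′
    injective S V V′ (S⊆V , _) (S⊆V′ , _) e =
      trans (sym ([p─q]∪q≡p S⊆V)) (trans (cong (_∪ S) e) ([p─q]∪q≡p S⊆V′))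
    surjective : ∀ U S → k U S ≢ 0ℤ → ∃ λ V → V ─ S ≡ U × g V S ≢ 0ℤ
    surjective U S kUS≢0 with 𝟙*≢0 (step? true A U) kUS≢0
    ... | weak , rest≢0 with 𝟙*≢0 (step? false (A ─ U) S) (λ e → rest≢0 (trans (cong (sgn U *_) e) (ℤ.*-zeroʳ (sgn U))))
    ...   | strict , _ = U ∪ S , U∪S─S≡U , λ g≡0 → kUS≢0
            (trans (cong (λ U → k U S) (sym U∪S─S≡U)) (trans (value (U ∪ S) S (steps⇒doubleStep weak strict)) g≡0))
      where
      U∪S─S≡U : (U ∪ S) ─ S ≡ U
      U∪S─S≡U = [p∪q]─q≡p (λ x∈S x∈U → proj₂ (∈─⁻ {p = A} (proj₁ strict x∈S)) x∈U)

  suc-[1+] : ∀ n → ℤ.suc -[1+ n ] ≡ - (+ n)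
  suc-[1+] zero    = refl
  suc-[1+] (suc n) = refl

  -- Order polynomial reciprocity, by induction on n. As the sign of A ─ U is the product of those
  -- of A and U, the recursion for weak chains turns into the left side of `Ω-pred` at x = -(n+1).
  weak-chains : HasSinks → ∀ A n → chains true A n ≡ sgn A * Ω A (- (+ n))
  weak-chains sinks A zero = trans (chains-zero true A) (empty A)
    where
    empty : ∀ A → 𝟙 (A ≟ˢ ⊥) ≡ sgn A * 𝟙 (A ≟ˢ ⊥)
    empty A with A ≟ˢ ⊥
    ... | yes refl = sym (cong (_* 1ℤ) (sgn-⊥ m))
    ... | no _     = sym (ℤ.*-zeroʳ (sgn A))
  weak-chains sinks A (suc n) = begin
    chains true A (suc n)
      ≡⟨ chains-suc true A n ⟩
    sum 𝓢 (λ U → 𝟙 (step? true A U) * chains true (A ─ U) n)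
      ≡⟨ ∑-cong (Finite.elems 𝓢) (λ U → 𝟙*-cong (step? true A U) λ (U⊆A , _) → trans (weak-chains sinks (A ─ U) n)
           (cong₂ (λ s y → s * Ω (A ─ U) y) (sgn-─ {p = A} {U} U⊆A) (sym (suc-[1+] n)))) ⟩
    sum 𝓢 (λ U → 𝟙 (step? true A U) * (sgn A * sgn U * Ω (A ─ U) (ℤ.suc -[1+ n ])))
      ≡⟨ ∑-cong (Finite.elems 𝓢) (λ U → regroup (𝟙 (step? true A U)) (sgn A) (sgn U) _) ⟩
    sum 𝓢 (λ U → sgn A * (𝟙 (step? true A U) * (sgn U * Ω (A ─ U) (ℤ.suc -[1+ n ]))))
      ≡⟨ ∑-*ˡ (Finite.elems 𝓢) (sgn A) _ ⟩
    sgn A * sum 𝓢 (λ U → 𝟙 (step? true A U) * (sgn U * Ω (A ─ U) (ℤ.suc -[1+ n ])))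
      ≡⟨ cong (sgn A *_) (Ω-pred sinks A -[1+ n ]) ⟩
    sgn A * Ω A -[1+ n ] ∎
    where
    open ≡-Reasoning
    regroup : ∀ d a u o → d * (a * u * o) ≡ a * (d * (u * o))
    regroup = solve-∀

-- Decompositions and colorings

lookup-ext : {xs ys : Vec A n} → (∀ i → lookup xs i ≡ lookup ys i) → xs ≡ ys
lookup-ext {xs = xs} {ys} h =
  trans (sym (Vec.tabulate∘lookup xs)) (trans (Vec.tabulate-cong h) (Vec.tabulate∘lookup ys))

⟪_⟫ : {P : Fin m → Set} → (∀ v → Dec (P v)) → Subset m
⟪ P? ⟫ = tabulate (does ∘ P?)

∈⟪⟫⁺ : {P : Fin m → Set} (P? : ∀ v → Dec (P v)) {v : Fin m} → P v → v ∈ ⟪ P? ⟫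
∈⟪⟫⁺ P? {v} Pv = Vec.lookup⇒[]= v _ (trans (Vec.lookup∘tabulate (does ∘ P?) v) (dec-true (P? v) Pv))

∈⟪⟫⁻ : {P : Fin m → Set} (P? : ∀ v → Dec (P v)) {v : Fin m} → v ∈ ⟪ P? ⟫ → P v
∈⟪⟫⁻ P? {v} v∈ with P? v | trans (sym (Vec.lookup∘tabulate (does ∘ P?) v)) (Vec.[]=⇒lookup v∈)
... | yes Pv | _ = Pv
... | no _   | ()

-- The pointwise form of `IsDecomposition`, from which the color of a vertex can be read off as the
-- index of its block.
record Partition (A : Subset m) (Ss : Vec (Subset m) n) : Set where
  field
    covers  : ∀ {v} → v ∈ A → ∃ λ i → v ∈ lookup Ss i
    within  : ∀ i {v} → v ∈ lookup Ss i → v ∈ A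
    unique  : ∀ i j {v} → v ∈ lookup Ss i → v ∈ lookup Ss j → i ≡ j

open Partition

partition-∷ : {A S : Subset m} {Ss : Vec (Subset m) n} → S ⊆ A → Partition (A ─ S) Ss → Partition A (S ∷ Ss)
partition-∷ {A = A} {S} {Ss} S⊆A P = record { covers = cov ; within = wit ; unique = uni }
  where
  cov : ∀ {v} → v ∈ A → ∃ λ i → v ∈ lookup (S ∷ Ss) i
  cov {v} v∈A with v ∈? S
  ... | yes v∈S = zero , v∈S
  ... | no v∉S  = let i , v∈ = covers P (x∈p∧x∉q⇒x∈p─q v∈A v∉S) in suc i , v∈
  wit : ∀ i {v} → v ∈ lookup (S ∷ Ss) i → v ∈ A
  wit zero    v∈ = S⊆A v∈
  wit (suc i) v∈ = p─q⊆p A S (within P i v∈)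
  uni : ∀ i j {v} → v ∈ lookup (S ∷ Ss) i → v ∈ lookup (S ∷ Ss) j → i ≡ j
  uni zero    zero    _   _   = refl
  uni zero    (suc j) v∈S v∈j = contradiction v∈S (proj₂ (∈─⁻ {p = A} (within P j v∈j)))
  uni (suc i) zero    v∈i v∈S = contradiction v∈S (proj₂ (∈─⁻ {p = A} (within P i v∈i)))
  uni (suc i) (suc j) v∈i v∈j = cong suc (unique P i j v∈i v∈j)

partition-tail : {A S : Subset m} {Ss : Vec (Subset m) n} → Partition A (S ∷ Ss) → Partition (A ─ S) Ss
partition-tail {A = A} {S} {Ss} P = record
  { covers = cov
  ; within = λ i v∈i → x∈p∧x∉q⇒x∈p─q (within P (suc i) v∈i) λ v∈S → contradiction (unique P zero (suc i) v∈S v∈i) λ ()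
  ; unique = λ i j v∈i v∈j → Fin.suc-injective (unique P (suc i) (suc j) v∈i v∈j)
  }
  where
  cov : ∀ {v} → v ∈ A ─ S → ∃ λ i → v ∈ lookup Ss i
  cov v∈ with ∈─⁻ {p = A} v∈
  ... | v∈A , v∉S with covers P v∈A
  ...   | zero  , v∈S = contradiction v∈S v∉S
  ...   | suc i , v∈i = i , v∈i

∈⋃⁻ : {v : Fin m} (Ss : Vec (Subset m) n) → v ∈ ⋃ (toList Ss) → ∃ λ i → v ∈ lookup Ss i
∈⋃⁻ []       v∈ = contradiction v∈ ∉⊥
∈⋃⁻ (S ∷ Ss) v∈ with x∈p∪q⁻ S _ v∈
... | inj₁ v∈S = zero , v∈S
... | inj₂ v∈′ = let i , v∈i = ∈⋃⁻ Ss v∈′ in suc i , v∈i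

∈⋃⁺ : {v : Fin m} (Ss : Vec (Subset m) n) (i : Fin n) → v ∈ lookup Ss i → v ∈ ⋃ (toList Ss)
∈⋃⁺ (S ∷ Ss) zero    v∈S = p⊆p∪q _ v∈S
∈⋃⁺ (S ∷ Ss) (suc i) v∈i = q⊆p∪q S _ (∈⋃⁺ Ss i v∈i)

disjoint⇒∉ : {p q : Subset m} {v : Fin m} → p ∩ q ≡ ⊥ → v ∈ p → v ∉ q
disjoint⇒∉ p∩q≡⊥ v∈p v∈q = ∉⊥ (subst (_ ∈_) p∩q≡⊥ (x∈p∩q⁺ (v∈p , v∈q)))

decomposition⇒partition : {A : Subset m} {Ss : Vec (Subset m) n} → IsDecomposition A Ss → Partition A Ss
decomposition⇒partition {Ss = Ss} (disj , refl) = record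
  { covers = ∈⋃⁻ Ss ; within = λ i → ∈⋃⁺ Ss i ; unique = uni Ss disj }
  where
  uni : ∀ {n} (Ss : Vec (Subset _) n) → AllPairs (λ S S′ → S ∩ S′ ≡ ⊥) Ss →
    ∀ i j {v} → v ∈ lookup Ss i → v ∈ lookup Ss j → i ≡ j
  uni (S ∷ Ss) (d ∷ ds) zero    zero    _   _   = refl
  uni (S ∷ Ss) (d ∷ ds) zero    (suc j) v∈S v∈j = contradiction v∈j (disjoint⇒∉ (VecAll.lookup⁺ d j) v∈S)
  uni (S ∷ Ss) (d ∷ ds) (suc i) zero    v∈i v∈S = contradiction v∈i (disjoint⇒∉ (VecAll.lookup⁺ d i) v∈S)
  uni (S ∷ Ss) (d ∷ ds) (suc i) (suc j) v∈i v∈j = cong suc (uni Ss ds i j v∈i v∈j)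

partition⇒decomposition : {A : Subset m} {Ss : Vec (Subset m) n} → Partition A Ss → IsDecomposition A Ss
partition⇒decomposition {A = A} {Ss} P =
  pairs Ss (unique P) , ⊆-antisym (λ v∈ → let i , v∈i = ∈⋃⁻ Ss v∈ in within P i v∈i)
    (λ v∈A → let i , v∈i = covers P v∈A in ∈⋃⁺ Ss i v∈i)
  where
  pairs : ∀ {n} (Ss : Vec (Subset _) n) → (∀ i j {v} → v ∈ lookup Ss i → v ∈ lookup Ss j → i ≡ j) →
    AllPairs (λ S S′ → S ∩ S′ ≡ ⊥) Ss
  pairs []       u = []
  pairs (S ∷ Ss) u = VecAll.lookup⁻ (λ j → Empty-unique λ (v , v∈) →
      let v∈S , v∈j = x∈p∩q⁻ S (lookup Ss j) v∈ in contradiction (u zero (suc j) v∈S v∈j) λ ()) ∷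
    pairs Ss (λ i j v∈i v∈j → Fin.suc-injective (u (suc i) (suc j) v∈i v∈j))

blocks : Vec (Fin n) m → Vec (Subset m) n
blocks c = tabulate λ i → ⟪ (λ v → lookup c v Fin.≟ i) ⟫

∈blocks⁺ : (c : Vec (Fin n) m) (v : Fin m) → v ∈ lookup (blocks c) (lookup c v)
∈blocks⁺ c v = subst (v ∈_) (sym (Vec.lookup∘tabulate _ (lookup c v))) (∈⟪⟫⁺ (λ u → lookup c u Fin.≟ lookup c v) refl)

∈blocks⁻ : (c : Vec (Fin n) m) {v : Fin m} (i : Fin n) → v ∈ lookup (blocks c) i → lookup c v ≡ i
∈blocks⁻ c {v} i v∈ = ∈⟪⟫⁻ (λ u → lookup c u Fin.≟ i) (subst (v ∈_) (Vec.lookup∘tabulate _ i) v∈)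

blocks-partition : (c : Vec (Fin n) m) → Partition ⊤ (blocks c)
blocks-partition c = record
  { covers = λ {v} _ → lookup c v , ∈blocks⁺ c v
  ; within = λ _ _ → ∈⊤
  ; unique = λ i j v∈i v∈j → trans (sym (∈blocks⁻ c i v∈i)) (∈blocks⁻ c j v∈j)
  }

blocks-injective : (c d : Vec (Fin n) m) → blocks c ≡ blocks d → c ≡ d
blocks-injective c d e = lookup-ext λ v →
  sym (∈blocks⁻ d (lookup c v) (subst (λ Ss → v ∈ lookup Ss (lookup c v)) e (∈blocks⁺ c v)))

blocks-surjective : {Ss : Vec (Subset m) n} → Partition ⊤ Ss → ∃ λ c → blocks c ≡ Ss
blocks-surjective {Ss = Ss} P = c , lookup-ext λ i → ⊆-antisym (to i) (from i)
  where
  color = λ v → proj₁ (covers P {v} ∈⊤)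
  c = tabulate color
  ∈color : ∀ v → v ∈ lookup Ss (lookup c v)
  ∈color v = subst (λ i → v ∈ lookup Ss i) (sym (Vec.lookup∘tabulate color v)) (proj₂ (covers P {v} ∈⊤))
  to : ∀ i → lookup (blocks c) i ⊆ lookup Ss i
  to i {v} v∈ = subst (λ i → v ∈ lookup Ss i) (∈blocks⁻ c i v∈) (∈color v)
  from : ∀ i → lookup Ss i ⊆ lookup (blocks c) i
  from i {v} v∈ = subst (λ i → v ∈ lookup (blocks c) i) (unique P (lookup c v) i (∈color v) v∈) (∈blocks⁺ c v)

module Chains {m : ℕ} {R : Fin m → Fin m → Set} (R? : ∀ u v → Dec (R u v)) where
  open OrderPolynomial R? public

  Increasing : Bool → Vec (Subset m) n → Set
  Increasing w Ss = ∀ {u v} i j → R u v → u ∈ lookup Ss i → v ∈ lookup Ss j → i Fin.< j ⊎ (T w × i ≡ j)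

  chain⇒partition : ∀ {w A} (Ss : Vec (Subset m) n) → Chain w A Ss → Partition A Ss
  chain⇒partition []       refl = record
    { covers = λ v∈⊥ → contradiction v∈⊥ ∉⊥ ; within = λ () ; unique = λ () }
  chain⇒partition (S ∷ Ss) ((S⊆A , _) , ch) = partition-∷ S⊆A (chain⇒partition Ss ch)

  chain⇒increasing : ∀ {w A} (Ss : Vec (Subset m) n) → Chain w A Ss → Increasing w Ss
  chain⇒increasing {A = A} (S ∷ Ss) ((S⊆A , closed) , ch) zero zero Ruv u∈ v∈ =
    inj₂ (proj₁ (closed _ _ Ruv (S⊆A u∈) v∈) , refl)
  chain⇒increasing (S ∷ Ss) _ zero (suc j) Ruv u∈ v∈ = inj₁ (s≤s z≤n)
  chain⇒increasing {A = A} (S ∷ Ss) ((S⊆A , closed) , ch) (suc i) zero Ruv u∈ v∈ =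
    let u∈A , u∉S = ∈─⁻ {p = A} (within (chain⇒partition Ss ch) i u∈)
    in contradiction (proj₂ (closed _ _ Ruv u∈A v∈)) u∉S
  chain⇒increasing (S ∷ Ss) (_ , ch) (suc i) (suc j) Ruv u∈ v∈ with chain⇒increasing Ss ch i j Ruv u∈ v∈
  ... | inj₁ i<j         = inj₁ (s≤s i<j)
  ... | inj₂ (tw , refl) = inj₂ (tw , refl)

  partition∧increasing⇒chain : ∀ {w A} (Ss : Vec (Subset m) n) → Partition A Ss → Increasing w Ss → Chain w A Ss
  partition∧increasing⇒chain []       P inc = Empty-unique λ (v , v∈A) → Fin.¬Fin0 (proj₁ (covers P v∈A))
  partition∧increasing⇒chain {w = w} {A} (S ∷ Ss) P inc =
    (within P zero , closed) , partition∧increasing⇒chain Ss (partition-tail P) inc′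
    where
    closed : ∀ u v → R u v → u ∈ A → v ∈ S → T w × u ∈ S
    closed u v Ruv u∈A v∈S with covers P u∈A
    ... | i , u∈i with inc i zero Ruv u∈i v∈S
    ...   | inj₂ (tw , refl) = tw , u∈i
    inc′ : Increasing w Ss
    inc′ i j Ruv u∈ v∈ with inc (suc i) (suc j) Ruv u∈ v∈
    ... | inj₁ (s≤s i<j)   = inj₁ i<j
    ... | inj₂ (tw , refl) = inj₂ (tw , refl)

  -- A vertex of V of highest color is a sink. It is found by discarding the lowest class as long as
  -- V has vertices outside it. Hence an orientation that admits a strictly increasing coloring is
  -- acyclic.
  strict-chain⇒sinks : ∀ {A} (Ss : Vec (Subset m) n) → Chain false A Ss →
    ∀ V → V ⊆ A → Nonempty V → ∃ λ v → v ∈ V × (∀ w → w ∈ V → ¬ R v w)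
  strict-chain⇒sinks []       refl V V⊆⊥ (v , v∈V) = contradiction (V⊆⊥ v∈V) ∉⊥
  strict-chain⇒sinks {A = A} (S ∷ Ss) ((S⊆A , closed) , ch) V V⊆A (v , v∈V) with nonempty? (V ─ S)
  ... | no empty = v , v∈V , λ w w∈V Rvw → proj₁ (closed v w Rvw (V⊆A v∈V) (V⊆S w∈V))
    where
    V⊆S : V ⊆ S
    V⊆S {u} u∈V with u ∈? S
    ... | yes u∈S = u∈S
    ... | no u∉S  = contradiction (u , x∈p∧x∉q⇒x∈p─q u∈V u∉S) empty
  ... | yes ne with strict-chain⇒sinks Ss ch (V ─ S)
                      (λ u∈ → let u∈V , u∉S = ∈─⁻ {p = V} u∈ in x∈p∧x∉q⇒x∈p─q (V⊆A u∈V) u∉S) ne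
  ...   | s , s∈V─S , sink = s , s∈V , sink′
    where
    s∈V = p─q⊆p V S s∈V─S
    sink′ : ∀ w → w ∈ V → ¬ R s w
    sink′ w w∈V Rsw with w ∈? S
    ... | yes w∈S = proj₁ (closed s w Rsw (V⊆A s∈V) w∈S)
    ... | no w∉S  = sink w (x∈p∧x∉q⇒x∈p─q w∈V w∉S) Rsw

  Weak : Vec (Fin n) m → Set
  Weak c = ∀ u v → R u v → lookup c u Fin.≤ lookup c v

  weak? : (c : Vec (Fin n) m) → Dec (Weak c)
  weak? c = Fin.all? λ u → Fin.all? λ v → R? u v →-dec (lookup c u Fin.≤? lookup c v)

  weak⇒chain : (c : Vec (Fin n) m) → Weak c → Chain true ⊤ (blocks c)
  weak⇒chain c weak = partition∧increasing⇒chain (blocks c) (blocks-partition c) inc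
    where
    inc : Increasing true (blocks c)
    inc {u} {v} i j Ruv u∈ v∈ with ∈blocks⁻ c i u∈ | ∈blocks⁻ c j v∈
    ... | refl | refl with ℕ.m≤n⇒m<n∨m≡n (weak u v Ruv)
    ...   | inj₁ lt = inj₁ lt
    ...   | inj₂ eq = inj₂ (_ , Fin.toℕ-injective eq)

  chain⇒weak : (c : Vec (Fin n) m) → Chain true ⊤ (blocks c) → Weak c
  chain⇒weak c ch u v Ruv with chain⇒increasing (blocks c) ch _ _ Ruv (∈blocks⁺ c u) (∈blocks⁺ c v)
  ... | inj₁ lt       = ℕ.<⇒≤ lt
  ... | inj₂ (_ , eq) = ℕ.≤-reflexive (cong toℕ eq)

  weak-colorings : ∀ n → sum (vecFinite (finFinite n) m) (λ c → 𝟙 (weak? c)) ≡ chains true ⊤ n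
  weak-colorings n = sym (sum-reindex (vecFinite 𝓢 n) (vecFinite (finFinite n) m) blocks
    (λ c _ → value c)
    (λ c d _ _ → blocks-injective c d)
    (λ Ss 𝟙≢0′ → surjective Ss (𝟙≢0 (chain? true ⊤ Ss) 𝟙≢0′)))
    where
    value : (c : Vec (Fin n) m) → 𝟙 (chain? true ⊤ (blocks c)) ≡ 𝟙 (weak? c)
    value c = 𝟙-cong (chain? true ⊤ (blocks c)) (weak? c) (chain⇒weak c) (weak⇒chain c)
    surjective : (Ss : Vec (Subset m) n) → Chain true ⊤ Ss → ∃ λ c → blocks c ≡ Ss × 𝟙 (weak? c) ≢ 0ℤ
    surjective Ss ch with blocks-surjective (chain⇒partition Ss ch)
    ... | c , refl = c , refl , λ e → contradiction (trans (sym (𝟙-yes (weak? c) (chain⇒weak c ch))) e) λ ()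

-- Acyclic orientations

subsingleton⇒∣p∣≤1 : {p : Subset m} → (∀ {u v} → u ∈ p → v ∈ p → u ≡ v) → ∣ p ∣ ℕ.≤ 1
subsingleton⇒∣p∣≤1 {m} {p} sub with nonempty? p
... | no empty = ℕ.≤-trans (ℕ.≤-reflexive (trans (cong ∣_∣ (Empty-unique empty)) (∣⊥∣≡0 m))) z≤n
... | yes (v , v∈p) = ℕ.≤-trans
  (p⊆q⇒∣p∣≤∣q∣ (λ {u} u∈p → subst (_∈ ⁅ v ⁆) (sub v∈p u∈p) (x∈⁅x⁆ v))) (ℕ.≤-reflexive (∣⁅x⁆∣≡1 v))

∣p∣≤1⇒subsingleton : {p : Subset m} {u v : Fin m} → ∣ p ∣ ℕ.≤ 1 → u ∈ p → v ∈ p → u ≡ v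
∣p∣≤1⇒subsingleton {p = p} {u} {v} ∣p∣≤1 u∈p v∈p with u Fin.≟ v
... | yes u≡v = u≡v
... | no u≢v  = contradiction
  (ℕ.<-≤-trans (ℕ.≤-<-trans (ℕ.≤-trans (ℕ.≤-reflexive (sym (∣⁅x⁆∣≡1 u)))
    (p⊆q⇒∣p∣≤∣q∣ (λ x∈ → subst (_∈ p - v) (sym (x∈⁅y⁆⇒x≡y u x∈)) (x∈p∧x≢y⇒x∈p-y u∈p u≢v)))) (x∈p⇒∣p-x∣<∣p∣ v∈p)) ∣p∣≤1)
  (ℕ.<-irrefl refl)

argmax : (c : Fin m → ℕ) (p : Subset m) → Nonempty p → ∃ λ v → v ∈ p × (∀ u → u ∈ p → c u ℕ.≤ c v)
argmax c (s ∷ p) ne with nonempty? p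
argmax c (s ∷ p) (zero , here) | no ¬ne =
  zero , here , λ { zero _ → ℕ.≤-refl ; (suc u) (there u∈) → contradiction (u , u∈) ¬ne }
argmax c (s ∷ p) (suc v , there v∈) | no ¬ne = contradiction (v , v∈) ¬ne
argmax c (outside ∷ p) _ | yes ne =
  let v , v∈ , max = argmax (c ∘ suc) p ne in suc v , there v∈ , λ { (suc u) (there u∈) → max u u∈ }
argmax c (inside ∷ p) _ | yes ne with argmax (c ∘ suc) p ne
... | v , v∈ , max with ℕ.≤-total (c zero) (c (suc v))
...   | inj₁ le = suc v , there v∈ , λ { zero _ → le ; (suc u) (there u∈) → max u u∈ }
...   | inj₂ ge = zero , here , λ { zero _ → ℕ.≤-refl ; (suc u) (there u∈) → ℕ.≤-trans (max u u∈) ge }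

∈prefix⁻ : (Ss : Vec (Subset m) n) (k : ℕ) {v : Fin m} → v ∈ prefix Ss k → ∃ λ i → toℕ i ℕ.< k × v ∈ lookup Ss i
∈prefix⁻ []       zero    v∈ = contradiction v∈ ∉⊥
∈prefix⁻ []       (suc k) v∈ = contradiction v∈ ∉⊥
∈prefix⁻ (S ∷ Ss) zero    v∈ = contradiction v∈ ∉⊥
∈prefix⁻ (S ∷ Ss) (suc k) v∈ with x∈p∪q⁻ S _ v∈
... | inj₁ v∈S = zero , s≤s z≤n , v∈S
... | inj₂ v∈′ = let i , i<k , v∈i = ∈prefix⁻ Ss k v∈′ in suc i , s≤s i<k , v∈i

∈prefix⁺ : (Ss : Vec (Subset m) n) (k : ℕ) {v : Fin m} (i : Fin n) → toℕ i ℕ.< k → v ∈ lookup Ss i → v ∈ prefix Ss k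
∈prefix⁺ (S ∷ Ss) (suc k) zero    i<k       v∈S = p⊆p∪q _ v∈S
∈prefix⁺ (S ∷ Ss) (suc k) (suc i) (s≤s i<k) v∈i = q⊆p∪q S _ (∈prefix⁺ Ss k i i<k v∈i)

-- First repetitions in orbits

module Orbit {N : ℕ} (g : Fin N → Fin N) (a : Fin N) where

  orbit : ℕ → Fin N
  orbit zero    = a
  orbit (suc t) = g (orbit t)

  InjectiveBelow : ℕ → Set
  InjectiveBelow n = ∀ {i j} → i ℕ.< n → j ℕ.< n → orbit i ≡ orbit j → i ≡ j

  -- A directed cycle consists of distinct edges. Taking the first repetition makes the elements
  -- with indices from i to j-1 distinct.
  FirstRepetition : Set
  FirstRepetition = ∃ λ j → InjectiveBelow j × ∃ λ i → i ℕ.< j × orbit i ≡ orbit j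

  injective-or-repetition : ∀ n → InjectiveBelow n ⊎ FirstRepetition
  injective-or-repetition zero    = inj₁ λ ()
  injective-or-repetition (suc n) with injective-or-repetition n
  ... | inj₂ rep = inj₂ rep
  ... | inj₁ inj with Fin.any? {n = n} (λ i → orbit (toℕ i) Fin.≟ orbit n)
  ...   | yes (i , e) = inj₂ (n , inj , toℕ i , Fin.toℕ<n i , e)
  ...   | no fresh = inj₁ λ i<1+n j<1+n → inj′ (ℕ.m<1+n⇒m<n∨m≡n i<1+n) (ℕ.m<1+n⇒m<n∨m≡n j<1+n)
    where
    new : ∀ {i} → i ℕ.< n → orbit i ≢ orbit n
    new i<n e = fresh (Fin.fromℕ< i<n , trans (cong orbit (Fin.toℕ-fromℕ< i<n)) e)
    inj′ : ∀ {i j} → i ℕ.< n ⊎ i ≡ n → j ℕ.< n ⊎ j ≡ n → orbit i ≡ orbit j → i ≡ j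
    inj′ (inj₁ i<n)  (inj₁ j<n)  e = inj i<n j<n e
    inj′ (inj₁ i<n)  (inj₂ refl) e = contradiction e (new i<n)
    inj′ (inj₂ refl) (inj₁ j<n)  e = contradiction (sym e) (new j<n)
    inj′ (inj₂ refl) (inj₂ refl) e = refl

  firstRepetition : FirstRepetition
  firstRepetition with injective-or-repetition (suc N)
  ... | inj₂ rep = rep
  ... | inj₁ inj with Fin.pigeonhole (ℕ.n<1+n N) (λ i → orbit (toℕ {suc N} i))
  ...   | i , j , i<j , e = contradiction (inj (Fin.toℕ<n i) (Fin.toℕ<n j) e) (ℕ.<⇒≢ i<j)

module _ {m : ℕ} {R : Fin m → Fin m → Set} (R? : ∀ u v → Dec (R u v)) where
  open OrderPolynomial R?

  -- The failure of `HasSinks` in positive form: every vertex of V is given a successor in V, so a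
  -- cycle can be constructed. A finite search decides between the two.
  Trap : Set
  Trap = ∃ λ V → Nonempty V × (∀ v → v ∈ V → ∃ λ w → w ∈ V × R v w)

  sinks-or-trap : HasSinks ⊎ Trap
  sinks-or-trap with anySubset? (λ V → nonempty? V ×-dec
    Fin.all? λ v → (v ∈? V) →-dec Fin.any? λ w → (w ∈? V) ×-dec R? v w)
  ... | yes trap = inj₂ trap
  ... | no ¬trap = inj₁ sinks
    where
    sinks : HasSinks
    sinks V ne with Fin.any? (λ v → (v ∈? V) ×-dec Fin.all? λ w → (w ∈? V) →-dec ¬? (R? v w))
    ... | yes sink = sink
    ... | no ¬sink = contradiction (V , ne , escape) ¬trap
      where
      escape : ∀ v → v ∈ V → ∃ λ w → w ∈ V × R v w
      escape v v∈V with Fin.any? (λ w → (w ∈? V) ×-dec R? v w)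
      ... | yes next = next
      ... | no ¬next = contradiction (v , v∈V , λ w w∈V Rvw → ¬next (w , w∈V , Rvw)) ¬sink

  hasSinks? : Dec HasSinks
  hasSinks? with sinks-or-trap
  ... | inj₁ sinks = yes sinks
  ... | inj₂ (V , ne , escape) = no λ sinks →
    let v , v∈V , sink = sinks V ne
        w , w∈V , Rvw = escape v v∈V
    in sink w w∈V Rvw

module Orientations {m : ℕ} (H : Hypergraph (⊤ {m})) where

  Arc : (Edge H → Fin m) → Fin m → Fin m → Set
  Arc f u v = ∃ λ e → u ∈ ⟦_⟧ H e × u ≢ v × f e ≡ v

  arc? : ∀ f u v → Dec (Arc f u v)
  arc? f u v = Fin.any? λ e → (u ∈? ⟦_⟧ H e) ×-dec ¬? (u Fin.≟ v) ×-dec (f e Fin.≟ v)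

  HasSinksᵒ : (Edge H → Fin m) → Set
  HasSinksᵒ f = OrderPolynomial.HasSinks (arc? f)

  hasSinks-resp-≗ : ∀ {f g} → f ≗ g → HasSinksᵒ f → HasSinksᵒ g
  hasSinks-resp-≗ f≗g sinks V ne =
    let v , v∈V , sink = sinks V ne
    in v , v∈V , λ w w∈V (e , v∈e , v≢w , ge≡w) → sink w w∈V (e , v∈e , v≢w , trans (f≗g e) ge≡w)

  edge-nonempty : ∀ e → Nonempty (⟦_⟧ H e)
  edge-nonempty e = All.lookup (All.all-filter nonempty? (edges H)) (∈-lookup e)

  -- The heads of the edges of a directed cycle form a nonempty set without a sink, since each head
  -- has an arc to the next one.
  sinks⇒acyclic : (f : Orientation H) → HasSinksᵒ (proj₁ f) → Acyclic H f
  sinks⇒acyclic (f , _) sinks (k , e , _ , steps , last) =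
    let v , v∈V , sink = sinks V (f (e zero) , ∈⟪⟫⁺ target? (zero , refl))
        i , fei≡v = ∈⟪⟫⁻ target? v∈V
        j , fei∈ = next i
        fei∈ej , fei∉ = ∈─⁻ {p = ⟦_⟧ H (e j)} fei∈
    in sink (f (e j)) (∈⟪⟫⁺ target? (j , refl))
         (subst (λ u → Arc f u (f (e j))) fei≡v (e j , fei∈ej , x∉⁅y⁆⇒x≢y fei∉ , refl))
    where
    target? : ∀ v → Dec (∃ λ i → f (e i) ≡ v)
    target? v = Fin.any? λ i → f (e i) Fin.≟ v
    V : Subset m
    V = ⟪ target? ⟫
    next : ∀ i → ∃ λ j → f (e i) ∈ ⟦_⟧ H (e j) - f (e j)
    next i with view i
    ... | ‵fromℕ          = zero , last
    ... | ‵inject₁ i′     = suc i′ , steps i′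

  -- An edge with head in V is followed by an edge that realises an arc from this head to a vertex
  -- of V. The walk on the finitely many edges repeats, and it closes up to a directed cycle at its
  -- first repetition.
  trap⇒cycle : (f : Orientation H) → Trap (arc? (proj₁ f)) → DirectedCycle H f
  trap⇒cycle (f , f∈) (V , (v₀ , v₀∈V) , escape) with escape v₀ v₀∈V
  ... | w₀ , w₀∈V , e₀ , _ , _ , refl = cycle firstRepetition
    where
    follow : (e : Edge H) → Dec (f e ∈ V) → Edge H
    follow e (yes fe∈V) = let w , w∈V , e′ , _ = escape (f e) fe∈V in e′
    -- A default value: by `stays`, the heads met along the orbit all lie in V.
    follow e (no _)     = e
    g : Edge H → Edge H
    g e = follow e (f e ∈? V)
    follow-step : ∀ e d → f e ∈ V → f (follow e d) ∈ V × f e ∈ ⟦_⟧ H (follow e d) - f (follow e d)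
    follow-step e (no fe∉V)  fe∈V = contradiction fe∈V fe∉V
    follow-step e (yes fe∈V) _ with escape (f e) fe∈V
    ... | _ , w∈V , e′ , fe∈e′ , fe≢w , refl = w∈V , x∈p∧x≢y⇒x∈p-y fe∈e′ fe≢w
    open Orbit g e₀
    stays : ∀ t → f (orbit t) ∈ V
    stays zero    = w₀∈V
    stays (suc t) = proj₁ (follow-step (orbit t) (f (orbit t) ∈? V) (stays t))
    step : ∀ t → f (orbit t) ∈ ⟦_⟧ H (orbit (suc t)) - f (orbit (suc t))
    step t = proj₂ (follow-step (orbit t) (f (orbit t) ∈? V) (stays t))
    cycle : FirstRepetition → DirectedCycle H (f , f∈)
    cycle (j , inj , i , i<j , xᵢ≡xⱼ) = k , e , e-injective , steps , last
      where
      -- The cycle has the k+1 = j-i edges with indices from i to j-1; the step from j-1 to j closes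
      -- it, because the edges at j and at i coincide.
      k = j ℕ.∸ suc i
      1+i+k≡j : suc (i ℕ.+ k) ≡ j
      1+i+k≡j = ℕ.m+[n∸m]≡n i<j
      e : Fin (suc k) → Edge H
      e t = orbit (i ℕ.+ toℕ t)
      below : (t : Fin (suc k)) → i ℕ.+ toℕ t ℕ.< j
      below t = ℕ.≤-trans (s≤s (ℕ.+-monoʳ-≤ i (ℕ.≤-pred (Fin.toℕ<n t)))) (ℕ.≤-reflexive 1+i+k≡j)
      e-injective : ∀ {s t} → e s ≡ e t → s ≡ t
      e-injective {s} {t} es≡et = Fin.toℕ-injective (ℕ.+-cancelˡ-≡ i _ _ (inj (below s) (below t) es≡et))
      steps : ∀ t → f (e (inject₁ t)) ∈ ⟦_⟧ H (e (suc t)) - f (e (suc t))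
      steps t = subst₂ (λ a b → f (orbit a) ∈ ⟦_⟧ H (orbit b) - f (orbit b))
        (cong (i ℕ.+_) (sym (Fin.toℕ-inject₁ t))) (sym (ℕ.+-suc i (toℕ t))) (step (i ℕ.+ toℕ t))
      last : f (e (fromℕ k)) ∈ ⟦_⟧ H (e zero) - f (e zero)
      last = subst₂ (λ a b → f (orbit a) ∈ ⟦_⟧ H b - f b)
        (cong (i ℕ.+_) (sym (Fin.toℕ-fromℕ k)))
        (trans (cong orbit 1+i+k≡j) (trans (sym xᵢ≡xⱼ) (cong orbit (sym (ℕ.+-identityʳ i)))))
        (step (i ℕ.+ k))

  acyclic⇒sinks : (f : Orientation H) → Acyclic H f → HasSinksᵒ (proj₁ f)
  acyclic⇒sinks f acyclic with sinks-or-trap (arc? (proj₁ f))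
  ... | inj₁ sinks = sinks
  ... | inj₂ trap  = contradiction (trap⇒cycle f trap) acyclic

-- Reciprocity

+-sumℕ-filter : {P : A → Set} (P? : ∀ x → Dec (P x)) (g : A → ℕ) (xs : List A) →
  + sumℕ (map g (filter P? xs)) ≡ ∑ xs (λ x → 𝟙 (P? x) * + g x)
+-sumℕ-filter P? g []       = refl
+-sumℕ-filter P? g (x ∷ xs) with P? x
... | yes _ = trans (ℤ.pos-+ (g x) _) (cong₂ _+_ (sym (ℤ.*-identityˡ (+ g x))) (+-sumℕ-filter P? g xs))
... | no _  = trans (+-sumℕ-filter P? g xs) (sym (ℤ.+-identityˡ _))

product-indicators : {P : Fin n → Set} (P? : ∀ i → Dec (P i)) (all? : Dec (∀ i → P i)) →
  + product (List.tabulate λ i → if does (P? i) then 1 else 0) ≡ 𝟙 all?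
product-indicators {zero}  P? all? = sym (𝟙-yes all? λ ())
product-indicators {suc n} P? all? with P? zero
... | no ¬P₀ = sym (𝟙-no all? λ all → ¬P₀ (all zero))
... | yes P₀ = trans (cong +_ (ℕ.*-identityˡ _)) (trans (product-indicators (P? ∘ suc) (Fin.all? (P? ∘ suc)))
  (𝟙-cong (Fin.all? (P? ∘ suc)) all? (λ { h zero → P₀ ; h (suc i) → h i }) (λ all i → all (suc i))))

module Reciprocity {m : ℕ} (H : Hypergraph (⊤ {m})) where
  open Orientations H
  module O (f : Edge H → Fin m) = Chains (arc? f)

  IsOrientation : (Edge H → Fin m) → Set
  IsOrientation f = ∀ e → f e ∈ ⟦_⟧ H e

  -- An acyclic orientation, with acyclicity replaced by the existence of sinks, which is decidable
  -- and is what `weak-chains` asks for.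
  Admissible : (Edge H → Fin m) → Set
  Admissible f = IsOrientation f × HasSinksᵒ f

  admissible? : ∀ f → Dec (Admissible f)
  admissible? f = Fin.all? (λ e → f e ∈? ⟦_⟧ H e) ×-dec hasSinks? (arc? f)

  DiscreteAlong : Vec (Subset m) n → Set
  DiscreteAlong Ss = IsDecomposition ⊤ Ss × (∀ i → Discrete (Δ H Ss i))

  discreteAlong? : (Ss : Vec (Subset m) n) → Dec (DiscreteAlong Ss)
  discreteAlong? Ss = isDecomposition? ⊤ Ss ×-dec Fin.all? (λ i → discrete? (Δ H Ss i))

  AdmissibleAlong : Vec (Subset m) n → (Edge H → Fin m) → Set
  AdmissibleAlong Ss f = Admissible f × O.Chain f false ⊤ Ss

  module Along {n : ℕ} (Ss : Vec (Subset m) n) (P : Partition ⊤ Ss) where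

    color : Fin m → Fin n
    color v = proj₁ (covers P {v} ∈⊤)

    ∈color : ∀ v → v ∈ lookup Ss (color v)
    ∈color v = proj₂ (covers P {v} ∈⊤)

    ∈⇒color : ∀ i {v} → v ∈ lookup Ss i → color v ≡ i
    ∈⇒color i {v} v∈ = unique P (color v) i (∈color v) v∈

    prefix⁺ : ∀ {v} k → toℕ (color v) ℕ.< k → v ∈ prefix Ss k
    prefix⁺ {v} k lt = ∈prefix⁺ Ss k (color v) lt (∈color v)

    prefix⁻ : ∀ {v} k → v ∈ prefix Ss k → toℕ (color v) ℕ.< k
    prefix⁻ {v} k v∈ = let i , i<k , v∈i = ∈prefix⁻ Ss k v∈ in subst (λ i → toℕ i ℕ.< k) (sym (∈⇒color i v∈i)) i<k

    -- The vertex set of the factor `Δ H Ss i`; `layer⁺` and `layer⁻` show that it consists of the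
    -- vertices of color i.
    layer : Fin n → Subset m
    layer i = prefix Ss (suc (toℕ i)) ─ prefix Ss (toℕ i)

    layer⁺ : ∀ {v} → v ∈ layer (color v)
    layer⁺ {v} = x∈p∧x∉q⇒x∈p─q (prefix⁺ _ ℕ.≤-refl) (λ v∈ → ℕ.<-irrefl refl (prefix⁻ (toℕ (color v)) v∈))

    layer⁻ : ∀ i {v} → v ∈ layer i → color v ≡ i
    layer⁻ i {v} v∈ with ∈─⁻ {p = prefix Ss (suc (toℕ i))} v∈
    ... | v∈+ , v∉ = Fin.toℕ-injective (ℕ.≤-antisym (ℕ.≤-pred (prefix⁻ _ v∈+)) (ℕ.≮⇒≥ (v∉ ∘ prefix⁺ _)))

    discrete⁻ : ∀ i → Discrete (Δ H Ss i) → ∀ {e} → e ∈ₗ edges H →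
      e ⊆ prefix Ss (suc (toℕ i)) → ¬ e ⊆ prefix Ss (toℕ i) → ∣ e ∩ layer i ∣ ℕ.≤ 1
    discrete⁻ i (_ ∷ disc) {e} e∈ e⊆ e⊈ = All.lookup disc (∈-map⁺ (_∩ layer i)
      (∈-filter⁺ (λ e → ¬? (e ⊆? prefix Ss (toℕ i))) (∈-filter⁺ (_⊆? prefix Ss (suc (toℕ i))) e∈ e⊆) e⊈))

    discrete⁺ : ∀ i → (∀ {e} → e ∈ₗ edges H →
      e ⊆ prefix Ss (suc (toℕ i)) → ¬ e ⊆ prefix Ss (toℕ i) → ∣ e ∩ layer i ∣ ℕ.≤ 1) → Discrete (Δ H Ss i)
    discrete⁺ i h = ℕ.≤-trans (ℕ.≤-reflexive (∣⊥∣≡0 m)) z≤n ∷ All.map⁺ (All.tabulate λ e∈ →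
      let e∈′ , e⊈ = ∈-filter⁻ (λ e → ¬? (e ⊆? prefix Ss (toℕ i))) e∈
          e∈″ , e⊆ = ∈-filter⁻ (_⊆? prefix Ss (suc (toℕ i))) {xs = edges H} e∈′
      in h e∈″ e⊆ e⊈)

    top : Edge H → Fin m
    top e = proj₁ (argmax (toℕ ∘ color) (⟦_⟧ H e) (edge-nonempty e))

    top∈ : ∀ e → top e ∈ ⟦_⟧ H e
    top∈ e = proj₁ (proj₂ (argmax (toℕ ∘ color) (⟦_⟧ H e) (edge-nonempty e)))

    top-max : ∀ e u → u ∈ ⟦_⟧ H e → color u Fin.≤ color (top e)
    top-max e = proj₂ (proj₂ (argmax (toℕ ∘ color) (⟦_⟧ H e) (edge-nonempty e)))

    -- Let i be the color of `top e`. The edge lies in the union of the blocks up to i but not in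
    -- that of the blocks before i, so its trace on the layer i is an edge of the factor i.
    -- Discreteness leaves room for one vertex in this trace, and `top e` is there.
    top-strict : (∀ i → Discrete (Δ H Ss i)) → ∀ e u → u ∈ ⟦_⟧ H e → u ≢ top e → color u Fin.< color (top e)
    top-strict disc e u u∈e u≢top with ℕ.m≤n⇒m<n∨m≡n (top-max e u u∈e)
    ... | inj₁ lt = lt
    ... | inj₂ eq = contradiction (∣p∣≤1⇒subsingleton
      (discrete⁻ i (disc i) (proj₁ (∈-filter⁻ nonempty? {xs = edges H} (∈-lookup e)))
        (λ {x} x∈e → prefix⁺ _ (s≤s (top-max e x x∈e)))
        (λ e⊆ → ℕ.<-irrefl refl (prefix⁻ (toℕ i) (e⊆ (top∈ e)))))
      (x∈p∩q⁺ (u∈e , subst (λ j → u ∈ layer j) (Fin.toℕ-injective eq) layer⁺))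
      (x∈p∩q⁺ (top∈ e , layer⁺))) u≢top
      where i = color (top e)

    top-chain : ∀ {f} → f ≗ top → (∀ i → Discrete (Δ H Ss i)) → O.Chain f false ⊤ Ss
    top-chain {f} f≗top disc = O.partition∧increasing⇒chain f Ss P inc
      where
      inc : O.Increasing f false Ss
      inc {u} i j (e , u∈e , u≢v , fe≡v) u∈i v∈j = inj₁ (subst₂ Fin._<_ (∈⇒color i u∈i) (∈⇒color j v∈j)
        (subst (λ w → color u Fin.< color w) top≡v (top-strict disc e u u∈e λ u≡top → u≢v (trans u≡top top≡v))))
        where top≡v = trans (sym (f≗top e)) fe≡v

    -- All vertices of an edge other than its head have a color strictly below that of the head. If
    -- the edge lies in the blocks up to i, the head has color at most i, so only the head can lie
    -- in the layer i.
    chain⇒discrete : ∀ {f} → IsOrientation f → O.Chain f false ⊤ Ss → ∀ i → Discrete (Δ H Ss i)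
    chain⇒discrete {f} f∈ ch i = discrete⁺ i subsingleton
      where
      subsingleton : ∀ {e} → e ∈ₗ edges H → e ⊆ prefix Ss (suc (toℕ i)) → ¬ e ⊆ prefix Ss (toℕ i) → ∣ e ∩ layer i ∣ ℕ.≤ 1
      subsingleton {e} e∈ e⊆ e⊈ = subsingleton⇒∣p∣≤1 λ u∈ v∈ → trans (isHead u∈) (sym (isHead v∈))
        where
        e≢⊥ : e ≢ ⊥
        e≢⊥ refl = e⊈ (⊆-min _)
        e∈′ : e ∈ₗ nonemptyEdges H
        e∈′ = ∈-filter⁺ nonempty? e∈ (≢⊥⇒Nonempty e≢⊥)
        ε : Edge H
        ε = Any.index e∈′
        e≡⟦ε⟧ : e ≡ ⟦_⟧ H ε
        e≡⟦ε⟧ = lookup-index e∈′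
        isHead : ∀ {u} → u ∈ e ∩ layer i → u ≡ f ε
        isHead {u} u∈ with u Fin.≟ f ε | x∈p∩q⁻ e (layer i) u∈
        ... | yes u≡fε | _ = u≡fε
        ... | no u≢fε  | u∈e , u∈layer with O.chain⇒increasing f Ss ch (color u) (color (f ε))
                 (ε , subst (u ∈_) e≡⟦ε⟧ u∈e , u≢fε , refl) (∈color u) (∈color (f ε))
        ...   | inj₁ lt = contradiction
          (ℕ.<-≤-trans (subst (Fin._< color (f ε)) (layer⁻ i u∈layer) lt)
            (ℕ.≤-pred (prefix⁻ _ (e⊆ (subst (f ε ∈_) (sym e≡⟦ε⟧) (f∈ ε))))))
          (ℕ.<-irrefl refl)

  -- If f and g differ at e, then `f e` and `g e` are distinct vertices of e, and each would have a
  -- color strictly below that of the other.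
  chains-agree : {Ss : Vec (Subset m) n} {f g : Edge H → Fin m} →
    AdmissibleAlong Ss f → AdmissibleAlong Ss g → f ≗ g
  chains-agree {Ss = Ss} {f} {g} ((f∈ , _) , chf) ((g∈ , _) , chg) e with f e Fin.≟ g e
  ... | yes fe≡ge = fe≡ge
  ... | no fe≢ge
    with O.chain⇒increasing f Ss chf _ _ (e , g∈ e , (fe≢ge ∘ sym) , refl) (∈color (g e)) (∈color (f e))
       | O.chain⇒increasing g Ss chg _ _ (e , f∈ e , fe≢ge , refl) (∈color (f e)) (∈color (g e))
    where open Along Ss (O.chain⇒partition f Ss chf)
  ... | inj₁ g<f | inj₁ f<g = contradiction (ℕ.<-trans g<f f<g) (ℕ.<-irrefl refl)

  𝓕 : Finite (Vec (Fin m) (length (nonemptyEdges H)))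
  𝓕 = vecFinite (finFinite m) _

  colorings : ∀ n → Finite (Vec (Fin n) m)
  colorings n = vecFinite (finFinite n) m

  decomps : ∀ n → Finite (Vec (Subset m) n)
  decomps n = vecFinite (subsetFinite m) n

  admissibleAlong? : (Ss : Vec (Subset m) n) → ∀ f → Dec (AdmissibleAlong Ss f)
  admissibleAlong? Ss f = admissible? f ×-dec O.chain? f false ⊤ Ss

  -- A decomposition with discrete factors comes from exactly one orientation:
  -- every edge points to its vertex in the last block that it meets.
  orientations-along : (Ss : Vec (Subset m) n) →
    sum 𝓕 (λ f → 𝟙 (admissibleAlong? Ss (lookup f))) ≡ 𝟙 (discreteAlong? Ss)
  orientations-along Ss = sum-𝟙-unique 𝓕 (admissibleAlong? Ss ∘ lookup) (discreteAlong? Ss)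
    (λ adf adg → lookup-ext (chains-agree adf adg))
    exists
    (λ {f} ((f∈ , _) , ch) → let P = O.chain⇒partition (lookup f) Ss ch in
      partition⇒decomposition P , Along.chain⇒discrete Ss P f∈ ch)
    where
    exists : DiscreteAlong Ss → ∃ λ f → AdmissibleAlong Ss (lookup f)
    exists (dec , disc) = tabulate top , (orients , sinks) , chain
      where
      open Along Ss (decomposition⇒partition dec)
      agrees : lookup (tabulate top) ≗ top
      agrees = Vec.lookup∘tabulate top
      orients : IsOrientation (lookup (tabulate top))
      orients e = subst (_∈ ⟦_⟧ H e) (sym (agrees e)) (top∈ e)
      chain : O.Chain (lookup (tabulate top)) false ⊤ Ss
      chain = top-chain agrees disc
      sinks : HasSinksᵒ (lookup (tabulate top))
      sinks V = O.strict-chain⇒sinks _ Ss chain V ⊆⊤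

  χ-discreteAlong : ∀ n → + χ H n ≡ sum (decomps n) (λ Ss → 𝟙 (discreteAlong? Ss))
  χ-discreteAlong n = trans
    (+-sumℕ-filter (isDecomposition? ⊤) (λ Ss → product (List.tabulate λ i → ζ (Δ H Ss i))) (Finite.elems (decomps n)))
    (∑-cong (Finite.elems (decomps n)) λ Ss → trans
      (cong (𝟙 (isDecomposition? ⊤ Ss) *_)
        (product-indicators (λ i → discrete? (Δ H Ss i)) (Fin.all? (λ i → discrete? (Δ H Ss i)))))
      (sym (𝟙-× (isDecomposition? ⊤ Ss) (Fin.all? (λ i → discrete? (Δ H Ss i))))))

  χ-polynomial : ℤ → ℤ
  χ-polynomial x = sum 𝓕 λ f → 𝟙 (admissible? (lookup f)) * O.Ω (lookup f) ⊤ x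

  χ-polynomialᵇ : Polynomialᵇ χ-polynomial
  χ-polynomialᵇ = polynomialᵇ-∑ (Finite.elems 𝓕) (λ f → 𝟙 (admissible? (lookup f)))
    (λ f → O.polynomialᵇ-Ω-fuel (lookup f) (suc m) ⊤)

  χ≡χ-polynomial : ∀ n → + χ H n ≡ χ-polynomial (+ n)
  χ≡χ-polynomial n = begin
    + χ H n
      ≡⟨ χ-discreteAlong n ⟩
    sum (decomps n) (λ Ss → 𝟙 (discreteAlong? Ss))
      ≡⟨ ∑-cong (Finite.elems (decomps n)) orientations-along ⟨
    sum (decomps n) (λ Ss → sum 𝓕 λ f → 𝟙 (admissibleAlong? Ss (lookup f)))
      ≡⟨ ∑-swap (Finite.elems (decomps n)) (Finite.elems 𝓕) _ ⟩
    sum 𝓕 (λ f → sum (decomps n) λ Ss → 𝟙 (admissibleAlong? Ss (lookup f)))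
      ≡⟨ ∑-cong (Finite.elems 𝓕) (λ f → trans
           (∑-cong (Finite.elems (decomps n)) λ Ss → 𝟙-× (admissible? (lookup f)) (O.chain? (lookup f) false ⊤ Ss))
           (trans (∑-*ˡ (Finite.elems (decomps n)) (𝟙 (admissible? (lookup f))) _)
             (cong (𝟙 (admissible? (lookup f)) *_) (O.strict-chains (lookup f) ⊤ n)))) ⟩
    χ-polynomial (+ n) ∎
    where open ≡-Reasoning

  -- Orientations and colorings as vectors: these can be enumerated up to propositional equality,
  -- whereas the functions in the statement are compared pointwise.
  Codes : ℕ → Set
  Codes n = Vec (Fin m) (length (nonemptyEdges H)) × Vec (Fin n) m

  IsPair : Codes n → Set
  IsPair (f , c) = Admissible (lookup f) × O.Weak (lookup f) c

  isPair? : (x : Codes n) → Dec (IsPair x)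
  isPair? (f , c) = admissible? (lookup f) ×-dec O.weak? (lookup f) c

  codes : ∀ n → List (Codes n)
  codes n = Finite.elems (𝓕 ×-finite colorings n)

  pairs : ℕ → ℕ
  pairs n = length (filter isPair? (codes n))

  reciprocity : ∀ n → -1ℤ ^ m * χ-polynomial (- (+ n)) ≡ + pairs n
  reciprocity n = sym (begin
    + pairs n
      ≡⟨ ∑-𝟙-length isPair? (codes n) ⟨
    ∑ (codes n) (λ x → 𝟙 (isPair? x))
      ≡⟨ ∑-cartesianProductWith _,_ (Finite.elems 𝓕) (Finite.elems (colorings n)) _ ⟩
    sum 𝓕 (λ f → sum (colorings n) λ c → 𝟙 (isPair? (f , c)))
      ≡⟨ ∑-cong (Finite.elems 𝓕) (λ f → trans
           (∑-cong (Finite.elems (colorings n)) λ c → 𝟙-× (admissible? (lookup f)) (O.weak? (lookup f) c))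
           (trans (∑-*ˡ (Finite.elems (colorings n)) (𝟙 (admissible? (lookup f))) _)
             -- Functions that are not admissible have coefficient 0, so the sinks that
             -- `weak-chains` requires may be assumed.
             (trans (𝟙*-cong (admissible? (lookup f)) λ (_ , sinks) →
                 trans (O.weak-colorings (lookup f) n) (O.weak-chains (lookup f) sinks ⊤ n))
               (commute (𝟙 (admissible? (lookup f))) (sgn (⊤ {m})) _)))) ⟩
    sum 𝓕 (λ f → sgn (⊤ {m}) * (𝟙 (admissible? (lookup f)) * O.Ω (lookup f) ⊤ (- (+ n))))
      ≡⟨ ∑-*ˡ (Finite.elems 𝓕) (sgn (⊤ {m})) _ ⟩
    sgn (⊤ {m}) * χ-polynomial (- (+ n))
      ≡⟨ cong (_* χ-polynomial (- (+ n))) (sgn-⊤ m) ⟩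
    -1ℤ ^ m * χ-polynomial (- (+ n)) ∎)
    where
    open ≡-Reasoning
    commute : ∀ a b c → a * (b * c) ≡ b * (a * c)
    commute = solve-∀

-- Cardinalities of setoids through codes

Unique⇒lookup-injective : {xs : List A} → Unique xs → ∀ {i j} → List.lookup xs i ≡ List.lookup xs j → i ≡ j
Unique⇒lookup-injective (p ∷ u) {zero}  {zero}  e = refl
Unique⇒lookup-injective (p ∷ u) {zero}  {suc j} e = contradiction e (All.lookup p (∈-lookup j))
Unique⇒lookup-injective (p ∷ u) {suc i} {zero}  e = contradiction (sym e) (All.lookup p (∈-lookup i))
Unique⇒lookup-injective (p ∷ u) {suc i} {suc j} e = cong suc (Unique⇒lookup-injective u e)

module _ (𝓐 : Finite A) {Q : A → Set} (Q? : ∀ a → Dec (Q a)) (X : Setoid 0ℓ 0ℓ) where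
  open Setoid X using (Carrier; _≈_) renaming (refl to ≈-refl; sym to ≈-sym; trans to ≈-trans)

  -- In the application the elements of X contain functions and proofs. All equations are therefore
  -- checked on their codes, where equality is propositional and the filtered enumeration has no
  -- repetitions.
  filter-cardinality : (enc : Carrier → A) (dec : ∀ a → Q a → Carrier) →
    (∀ {x y} → x ≈ y → enc x ≡ enc y) → (∀ x → Q (enc x)) →
    (∀ a q → enc (dec a q) ≡ a) → (∀ {x y} → enc x ≡ enc y → x ≈ y) →
    HasCardinality X (length (filter Q? (Finite.elems 𝓐)))
  filter-cardinality enc dec enc-cong Q-enc enc-dec enc-inj = record
    { to        = to
    ; from      = from
    ; to-cong   = λ { refl → ≈-refl }
    ; from-cong = λ {x} {y} x≈y → injective (trans (sym (lookup-from x)) (trans (enc-cong x≈y) (lookup-from y)))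
    ; inverse   = (λ { {x} refl → enc-inj (trans (enc-to (from x)) (sym (lookup-from x))) })
                , (λ {i} {x} x≈toi → injective (trans (sym (lookup-from x)) (trans (enc-cong x≈toi) (enc-to i))))
    }
    where
    L = filter Q? (Finite.elems 𝓐)
    injective : ∀ {i j} → List.lookup L i ≡ List.lookup L j → i ≡ j
    injective = Unique⇒lookup-injective (Unique.filter⁺ Q? (Finite.unique 𝓐))
    to : Fin (length L) → Carrier
    to i = dec (List.lookup L i) (All.lookup (All.all-filter Q? (Finite.elems 𝓐)) (∈-lookup i))
    enc-to : ∀ i → enc (to i) ≡ List.lookup L i
    enc-to i = enc-dec _ _
    enc∈ : ∀ x → enc x ∈ₗ L
    enc∈ x = ∈-filter⁺ Q? (Finite.complete 𝓐 (enc x)) (Q-enc x)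
    from : Carrier → Fin (length L)
    from x = Any.index (enc∈ x)
    lookup-from : ∀ x → enc x ≡ List.lookup L (from x)
    lookup-from x = lookup-index (enc∈ x)

tabulate-injective : {f g : Fin n → A} → tabulate f ≡ tabulate g → f ≗ g
tabulate-injective {f = f} {g} e i =
  trans (sym (Vec.lookup∘tabulate f i)) (trans (cong (λ v → lookup v i) e) (Vec.lookup∘tabulate g i))

module _ {m : ℕ} (H : Hypergraph (⊤ {m})) where
  open Orientations H
  open Reciprocity H

  compatible⇒weak : (f : Orientation H) (S : Coloring m n) → Compatible H f S → ∀ {u v} → Arc (proj₁ f) u v → S u Fin.≤ S v
  compatible⇒weak f S comp (e , u∈e , _ , refl) = proj₂ (comp e) _ u∈e

  weak⇒compatible : (f : Orientation H) (S : Coloring m n) → (∀ u v → Arc (proj₁ f) u v → S u Fin.≤ S v) → Compatible H f S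
  weak⇒compatible (f , f∈) S weak e = (f e , f∈ e , refl) , max
    where
    max : ∀ v → v ∈ ⟦_⟧ H e → S v Fin.≤ S (f e)
    max v v∈e with v Fin.≟ f e
    ... | yes refl = ℕ.≤-refl
    ... | no v≢fe  = weak v (f e) (e , v∈e , v≢fe , refl)

  pairs-cardinality : ∀ n → HasCardinality (CompatiblePairs H n) (pairs n)
  pairs-cardinality n = filter-cardinality (𝓕 ×-finite colorings n) isPair? (CompatiblePairs H n)
    (λ ((f , S) , _) → tabulate (proj₁ f) , tabulate S)
    decode
    (λ (f≗g , S≗T) → cong₂ _,_ (Vec.tabulate-cong f≗g) (Vec.tabulate-cong S≗T))
    encodes
    (λ (f , c) _ → cong₂ _,_ (Vec.tabulate∘lookup f) (Vec.tabulate∘lookup c))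
    (λ e → tabulate-injective (cong proj₁ e) , tabulate-injective (cong proj₂ e))
    where
    decode : ∀ x → IsPair x → Setoid.Carrier (CompatiblePairs H n)
    decode (f , c) ((f∈ , sinks) , weak) =
      ((lookup f , f∈) , lookup c) , sinks⇒acyclic (lookup f , f∈) sinks , weak⇒compatible (lookup f , f∈) (lookup c) weak
    encodes : ∀ x → IsPair (tabulate (proj₁ (proj₁ (proj₁ x))) , tabulate (proj₂ (proj₁ x)))
    encodes (((f , f∈) , S) , acyclic , comp) =
      ((λ e → subst (_∈ ⟦_⟧ H e) (f≗ e) (f∈ e)) , hasSinks-resp-≗ f≗ (acyclic⇒sinks (f , f∈) acyclic)) ,
      λ u v (e , u∈e , u≢v , fe≡v) → subst₂ Fin._≤_ (sym (Vec.lookup∘tabulate S u)) (sym (Vec.lookup∘tabulate S v))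
        (compatible⇒weak (f , f∈) S comp (e , u∈e , u≢v , trans (f≗ e) fe≡v))
      where
      f≗ : f ≗ lookup (tabulate f)
      f≗ e = sym (Vec.lookup∘tabulate f e)

  -- There is exactly one coloring with a single color, and every orientation is compatible with it.
  forgetColoring : Inverse (CompatiblePairs H 1) (AcyclicOrientations H)
  forgetColoring = record
    { to        = λ ((f , _) , acyclic , _) → f , acyclic
    ; from      = λ (f , acyclic) → (f , λ _ → zero) , acyclic ,
                    weak⇒compatible f (λ _ → zero) (λ _ _ _ → z≤n)
    ; to-cong   = proj₁
    ; from-cong = λ f≗g → f≗g , λ _ → refl
    ; inverse   = proj₁ , λ {((_ , S) , _)} f≗g → f≗g , λ v → constant (S v)
    }
    where
    constant : (i : Fin 1) → zero ≡ i
    constant zero = refl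

theorem16 : (m : ℕ) (H : Hypergraph (⊤ {m})) →
    ∃ λ (p : Polynomial) → p IsPolynomialOf H
    × ((n : ℕ) → ∃ λ (k : ℕ) → HasCardinality (CompatiblePairs H n) k
    × fromℤ (-1ℤ ^ m) ℚ.* eval p (- (+ n)) ≡ fromℤ (+ k))
    × (∃ λ (k : ℕ) → HasCardinality (AcyclicOrientations H) k
    × fromℤ (-1ℤ ^ m) ℚ.* eval p -1ℤ ≡ fromℤ (+ k))
theorem16 m H = fromBinomial 0 cs
  , (λ n → trans (eval-p (+ n)) (cong fromℤ (sym (χ≡χ-polynomial n))))
  , (λ n → pairs n , pairs-cardinality H n , reciprocal n)
  , pairs 1 , inverse (pairs-cardinality H 1) (forgetColoring H) , reciprocal 1
  where
  open Reciprocity H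
  cs : List ℤ
  cs = proj₁ χ-polynomialᵇ
  eval-p : ∀ x → eval (fromBinomial 0 cs) x ≡ fromℤ (χ-polynomial x)
  eval-p x = trans (eval-fromBinomial cs x) (cong fromℤ (proj₂ χ-polynomialᵇ x))
  reciprocal : ∀ n → fromℤ (-1ℤ ^ m) ℚ.* eval (fromBinomial 0 cs) (- (+ n)) ≡ fromℤ (+ pairs n)
  reciprocal n = trans (cong (fromℤ (-1ℤ ^ m) ℚ.*_) (eval-p (- (+ n))))
    (trans (sym (fromℤ-* (-1ℤ ^ m) _)) (cong fromℤ (reciprocity n)))
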